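{- Let $A,B,C,a,b\in\mathbb{R}$ and let $\{F_n\}$ be the sequence of real numbers defined by $F_0=a$, $F_1=b$ and $$F_{n+2}=A+BF_{n+1}+CF_n\qquad (n\ge 0).$$ If $|B|<2$ and $C=-1$, then $\{F_n\}$ is a periodic sequence with period $T=\frac{2\pi}{\omega}$, where $\omega=\arccos\frac{B}{2}$, and $T>2$.
   Context: $\arccos$ denotes the principal branch, with values in $[0,\pi]$. -}

module Defs where

open import Level using (_⊔_) renaming (suc to lsuc)
open import Algebra.Apartness.Bundles using (HeytingField; HeytingCommutativeRing)
open import Algebra.Bundles using (CommutativeRing; Semiring)
import Algebra.Definitions.RawSemiring as RawSemiringDefinitions
open import Data.Nat.Base as ℕ using (ℕ; zero; suc; NonZero; _!)
open import Data.Nat.Properties using (_!≢0)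
open import Data.Product.Base using (∃-syntax; _×_; proj₁; proj₂)
open import Data.Sum.Base using (_⊎_; inj₂)
open import Function.Bundles using (_⇔_; Equivalence)
open import Relation.Binary.Core using (Rel)
open import Relation.Binary.Structures using (IsStrictPartialOrder)
open import Relation.Nullary.Negation using (¬_)

record OrderedField c ℓ₁ ℓ₂ ℓ₃ : Set (lsuc (c ⊔ ℓ₁ ⊔ ℓ₂ ⊔ ℓ₃)) where
  infix 4 _<_ _≤_ ∣_∣<_
  infixl 7 _/_⟨_⟩

  field
    heytingField : HeytingField c ℓ₁ ℓ₂

  open HeytingField heytingField public

  field
    _<_                  : Rel Carrier ℓ₃
    isStrictPartialOrder : IsStrictPartialOrder _≈_ _<_
    #⇔<⊎>                : ∀ {x y} → (x # y) ⇔ (x < y ⊎ y < x)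
    0<1                  : 0# < 1#
    +-monoˡ-<            : ∀ {x y} z → x < y → x + z < y + z
    *-pos                : ∀ {x y} → 0# < x → 0# < y → 0# < x * y

  open IsStrictPartialOrder isStrictPartialOrder public
    using (<-resp-≈)
    renaming (irrefl to <-irrefl; trans to <-trans; asym to <-asym)

  commutativeRing : CommutativeRing c ℓ₁
  commutativeRing = HeytingCommutativeRing.commutativeRing heytingCommutativeRing

  open RawSemiringDefinitions
         (Semiring.rawSemiring (CommutativeRing.semiring commutativeRing)) public
    using (_^_)
    renaming (_×_ to _×ᴿ_)

  _≤_ : Rel Carrier ℓ₃
  x ≤ y = ¬ (y < x)

  -- ∣ x ∣< r is |x| < r; no supremum of x and - x is needed to state it.
  ∣_∣<_ : Rel Carrier ℓ₃
  ∣ x ∣< r = (- r < x) × (x < r)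

  fromℕ : ℕ → Carrier
  fromℕ n = n ×ᴿ 1#

  -- #⇒invertible inverts the difference y - 0#, which is ≈ y.
  _/_⟨_⟩ : (x y : Carrier) → y # 0# → Carrier
  x / y ⟨ y#0 ⟩ = x * proj₁ (#⇒invertible y#0)

  0<fromℕ-suc : ∀ n → 0# < fromℕ (suc n)
  0<fromℕ-suc zero    = proj₁ <-resp-≈ (sym (+-identityʳ 1#)) 0<1
  0<fromℕ-suc (suc n) =
    <-trans (0<fromℕ-suc n)
      (proj₂ <-resp-≈ (+-identityˡ _) (+-monoˡ-< (fromℕ (suc n)) 0<1))

  fromℕ#0 : ∀ n → .{{NonZero n}} → fromℕ n # 0#
  fromℕ#0 (suc n) = Equivalence.from #⇔<⊎> (inj₂ (0<fromℕ-suc n))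

  IsCauchy : (ℕ → Carrier) → Set (c ⊔ ℓ₃)
  IsCauchy s = ∀ ε → 0# < ε → ∃[ N ] ∀ m n → N ℕ.≤ m → N ℕ.≤ n → ∣ s m - s n ∣< ε

  infix 4 _⟶_
  _⟶_ : (ℕ → Carrier) → Carrier → Set (c ⊔ ℓ₃)
  s ⟶ l = ∀ ε → 0# < ε → ∃[ N ] ∀ n → N ℕ.≤ n → ∣ s n - l ∣< ε

-- The real numbers, characterised as the complete Archimedean ordered field.
-- The axioms hold both for the classical reals and, constructively, for the
-- Cauchy reals, so no form of excluded middle is built in.
record RealNumbers c ℓ₁ ℓ₂ ℓ₃ : Set (lsuc (c ⊔ ℓ₁ ⊔ ℓ₂ ⊔ ℓ₃)) where
  field
    orderedField : OrderedField c ℓ₁ ℓ₂ ℓ₃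

  open OrderedField orderedField public

  field
    archimedean : ∀ x → ∃[ n ] x < fromℕ n
    complete    : ∀ s → IsCauchy s → ∃[ l ] s ⟶ l

module Analysis {c ℓ₁ ℓ₂ ℓ₃} (ℝ : RealNumbers c ℓ₁ ℓ₂ ℓ₃) where
  open RealNumbers ℝ

  partialSums : (ℕ → Carrier) → ℕ → Carrier
  partialSums t zero      = 0#
  partialSums t (suc n) = partialSums t n + t n

  cosTerm : Carrier → ℕ → Carrier
  cosTerm x k = (- 1#) ^ k * (x ^ (2 ℕ.* k) / fromℕ (d !) ⟨ fromℕ#0 (d !) {{d !≢0}} ⟩)
    where d = 2 ℕ.* k

  sinTerm : Carrier → ℕ → Carrier
  sinTerm x k = (- 1#) ^ k * (x ^ d / fromℕ (d !) ⟨ fromℕ#0 (d !) {{d !≢0}} ⟩)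
    where d = 2 ℕ.* k ℕ.+ 1

  -- Graphs of cosine and sine: Cos x y says cos x = y.
  Cos : Carrier → Carrier → Set (c ⊔ ℓ₃)
  Cos x y = partialSums (cosTerm x) ⟶ y

  Sin : Carrier → Carrier → Set (c ⊔ ℓ₃)
  Sin x y = partialSums (sinTerm x) ⟶ y

  -- π is the least positive zero of sine.
  IsPi : Carrier → Set (c ⊔ ℓ₃)
  IsPi π = 0# < π × Sin π 0# × (∀ x → 0# < x → x < π → ¬ Sin x 0#)

  -- IsArccos π x ω says ω = arccos x, for the branch with values in [0,π].
  IsArccos : (π x ω : Carrier) → Set (c ⊔ ℓ₃)
  IsArccos π x ω = 0# ≤ ω × ω ≤ π × Cos ω x

  Continuous : (Carrier → Carrier) → Set (c ⊔ ℓ₃)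
  Continuous f = ∀ x ε → 0# < ε →
    ∃[ δ ] 0# < δ × (∀ y → ∣ y - x ∣< δ → ∣ f y - f x ∣< ε)

  -- T need not be an integer, so F (n + T) has no direct meaning: F has period T
  -- when it is the restriction to ℕ of a continuous T-periodic function.
  -- Continuity matters: for irrational T every sequence has some T-periodic
  -- extension, but at most one continuous one.  For T = p / q in lowest terms
  -- the condition is F (n + p) ≈ F n for all n.
  HasPeriod : (ℕ → Carrier) → Carrier → Set (c ⊔ ℓ₁ ⊔ ℓ₃)
  HasPeriod F T = ∃[ f ] Continuous f
                       × (∀ t → f (t + T) ≈ f t)
                       × (∀ n → f (fromℕ n) ≈ F n)

{-# OPTIONS --safe #-}
-- Put γ = A / (2 − B).  Since B = 2 cos ω, the recurrence is solved by
-- f (n) = α cos (ω n) + β sin (ω n) + γ, and α, β can be fitted to a, b because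
-- sin² ω = 1 − B²/4 > 0.  This f is continuous on the line with period 2π/ω.
-- From −1 < B/2 < 1 and cos π = −1, continuity of cosine gives 0 < ω < π, so
-- that 2π/ω > 2.
--
-- Cosine and sine are the power series with coefficients Re i^k and Im i^k.
-- Their addition formulas come from the Cauchy product: the difference of a
-- square and a triangular partial sum is bounded by the corresponding
-- difference for the exponential series of a majorant.
module Submission where

import Algebra.Properties.AbelianGroup
import Algebra.Properties.Ring
import Algebra.Properties.Semiring.Mult
import Algebra.Properties.Semiring.Mult.TCOptimised
import Algebra.Solver.Ring
import Data.Integer.Properties as ℤ
import Data.Nat.Properties as ℕ
import Relation.Binary.Reasoning.Base.Triple
import Relation.Binary.Reasoning.Setoid
open import Algebra.Bundles using (CommutativeRing)
open import Algebra.Solver.Ring.AlmostCommutativeRing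
  using (fromCommutativeRing; _-Raw-AlmostCommutative⟶_)
open import Data.Integer.Base as ℤ using (ℤ; +_; -[1+_]; _⊖_; _◃_)
open import Data.Maybe.Base using (Maybe; just; nothing)
open import Data.Nat.Base as ℕ using (ℕ; zero; suc; NonZero; _!)
open import Data.Product.Base using (∃-syntax; Σ-syntax; _×_; _,_; proj₁; proj₂)
open import Data.Sign.Base as Sign using (Sign)
open import Data.Sum.Base using (_⊎_; inj₁; inj₂; [_,_]′)
open import Defs
open import Function.Base using (_∘_; flip)
open import Function.Bundles using (Equivalence)
open import Relation.Binary.PropositionalEquality.Core as ≡ using ()
open import Relation.Binary.Structures using (IsPreorder)
open import Relation.Nullary.Decidable.Core using (yes; no)
open import Relation.Nullary.Negation using (¬_; contradiction)

-- The order is not decidable here: a real need not be comparable with `0#`, and being apart from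
-- `0#` says more than `¬ (x ≈ 0#)`. Two devices replace case distinctions. Cotransitivity picks a
-- side of a gap `x < y`, so a strict inequality has to be won from a margin; this is why `0# < ω`
-- and `ω < π` come from a modulus of continuity at the end points, and not merely from `cos ω`
-- differing from `1#` and `- 1#`. Tightness lets an equality be proved by refuting apartness; this
-- is how the minimality of `π`, a purely negative statement, can determine `cos π`. Absolute
-- values, minima and maxima are likewise replaced by two-sided bounds, common lower bounds and sums
-- of bounds.

-- Polynomial identities with integer coefficients.

module IntegerRingSolver {c ℓ} (R : CommutativeRing c ℓ) where
  open CommutativeRing R
  open Algebra.Properties.AbelianGroup +-abelianGroup using (⁻¹-∙-comm; ⁻¹-involutive; ε⁻¹≈ε)
  open Algebra.Properties.Ring ring using (-‿distribˡ-*)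
  open Algebra.Properties.Semiring.Mult.TCOptimised semiring
    using (1+×; ×-homo-+; ×1-homo-*) renaming (_×_ to _×ᴿ_)
  open Relation.Binary.Reasoning.Setoid setoid

  -- With this version of `×` the value at `+ 1` computes to `1#`, so `con (+ 1)` denotes `1#`
  -- itself. `fromℕ` uses the plain version, where `fromℕ 2` is `1# + (1# + 0#)`; hence the longer
  -- spelling of two in solver calls.
  fromℤ : ℤ → Carrier
  fromℤ (+ n)    = n ×ᴿ 1#
  fromℤ -[1+ n ] = - (suc n ×ᴿ 1#)

  fromℤ-neg : ∀ i → fromℤ (ℤ.- i) ≈ - fromℤ i
  fromℤ-neg (+ zero)  = sym ε⁻¹≈ε
  fromℤ-neg (+ suc n) = refl
  fromℤ-neg -[1+ n ]  = sym (⁻¹-involutive _)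

  fromℤ-⊖ : ∀ m n → fromℤ (m ⊖ n) ≈ m ×ᴿ 1# - n ×ᴿ 1#
  fromℤ-⊖ zero    zero    = sym (-‿inverseʳ 0#)
  fromℤ-⊖ zero    (suc n) = sym (+-identityˡ _)
  fromℤ-⊖ (suc m) zero    = sym (trans (+-congˡ ε⁻¹≈ε) (+-identityʳ _))
  fromℤ-⊖ (suc m) (suc n) = begin
    fromℤ (suc m ⊖ suc n)              ≡⟨ ≡.cong fromℤ (ℤ.[1+m]⊖[1+n]≡m⊖n m n) ⟩
    fromℤ (m ⊖ n)                      ≈⟨ fromℤ-⊖ m n ⟩
    M - N                              ≈⟨ +-congʳ (+-identityʳ M) ⟨
    M + 0# - N                         ≈⟨ +-congʳ (+-congˡ (-‿inverseʳ 1#)) ⟨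
    M + (1# - 1#) - N                  ≈⟨ +-congʳ (+-assoc M 1# (- 1#)) ⟨
    M + 1# - 1# - N                    ≈⟨ +-assoc (M + 1#) (- 1#) (- N) ⟩
    M + 1# + (- 1# - N)                ≈⟨ +-cong (+-comm M 1#) (⁻¹-∙-comm 1# N) ⟩
    1# + M - (1# + N)                  ≈⟨ +-cong (1+× m 1#) (-‿cong (1+× n 1#)) ⟨
    suc m ×ᴿ 1# - suc n ×ᴿ 1#            ∎
    where
    M = m ×ᴿ 1#
    N = n ×ᴿ 1#

  fromℤ-+ : ∀ i j → fromℤ (i ℤ.+ j) ≈ fromℤ i + fromℤ j
  fromℤ-+ (+ m)    (+ n)    = ×-homo-+ 1# m n
  fromℤ-+ (+ m)    -[1+ n ] = fromℤ-⊖ m (suc n)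
  fromℤ-+ -[1+ m ] (+ n)    = trans (fromℤ-⊖ n (suc m)) (+-comm _ _)
  fromℤ-+ -[1+ m ] -[1+ n ] = begin
    - (suc (suc (m ℕ.+ n)) ×ᴿ 1#)       ≡⟨ ≡.cong (λ k → - (k ×ᴿ 1#)) (ℕ.+-suc (suc m) n) ⟨
    - ((suc m ℕ.+ suc n) ×ᴿ 1#)         ≈⟨ -‿cong (×-homo-+ 1# (suc m) (suc n)) ⟩
    - (suc m ×ᴿ 1# + suc n ×ᴿ 1#)        ≈⟨ ⁻¹-∙-comm _ _ ⟨
    - (suc m ×ᴿ 1#) - suc n ×ᴿ 1#        ∎

  fromSign : Sign → Carrier
  fromSign Sign.+ = 1#
  fromSign Sign.- = - 1#

  -1*x≈-x : ∀ x → - 1# * x ≈ - x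
  -1*x≈-x x = trans (sym (-‿distribˡ-* 1# x)) (-‿cong (*-identityˡ x))

  fromSign-* : ∀ s t → fromSign (s Sign.* t) ≈ fromSign s * fromSign t
  fromSign-* Sign.+ t      = sym (*-identityˡ _)
  fromSign-* Sign.- Sign.+ = sym (*-identityʳ _)
  fromSign-* Sign.- Sign.- = sym (trans (-1*x≈-x _) (⁻¹-involutive 1#))

  fromℤ-◃ : ∀ s n → fromℤ (s ◃ n) ≈ fromSign s * (n ×ᴿ 1#)
  fromℤ-◃ s      zero    = sym (zeroʳ _)
  fromℤ-◃ Sign.+ (suc n) = sym (*-identityˡ _)
  fromℤ-◃ Sign.- (suc n) = sym (-1*x≈-x _)

  fromℤ-* : ∀ i j → fromℤ (i ℤ.* j) ≈ fromℤ i * fromℤ j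
  fromℤ-* i j = begin
    fromℤ (i ℤ.* j)                    ≈⟨ fromℤ-◃ (s Sign.* t) (m ℕ.* n) ⟩
    fromSign (s Sign.* t) * ((m ℕ.* n) ×ᴿ 1#)
      ≈⟨ *-cong (fromSign-* s t) (×1-homo-* m n) ⟩
    (S * T) * (M * N)                  ≈⟨ *-assoc S T (M * N) ⟩
    S * (T * (M * N))                  ≈⟨ *-congˡ (*-assoc T M N) ⟨
    S * ((T * M) * N)                  ≈⟨ *-congˡ (*-congʳ (*-comm T M)) ⟩
    S * ((M * T) * N)                  ≈⟨ *-congˡ (*-assoc M T N) ⟩
    S * (M * (T * N))                  ≈⟨ *-assoc S M (T * N) ⟨
    (S * M) * (T * N)                  ≈⟨ *-cong (fromℤ-sign i) (fromℤ-sign j) ⟨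
    fromℤ i * fromℤ j                  ∎
    where
    s = ℤ.sign i
    t = ℤ.sign j
    m = ℤ.∣ i ∣
    n = ℤ.∣ j ∣
    S = fromSign s
    T = fromSign t
    M = m ×ᴿ 1#
    N = n ×ᴿ 1#
    fromℤ-sign : ∀ k → fromℤ k ≈ fromSign (ℤ.sign k) * (ℤ.∣ k ∣ ×ᴿ 1#)
    fromℤ-sign k = trans (reflexive (≡.cong fromℤ (≡.sym (ℤ.◃-inverse k)))) (fromℤ-◃ (ℤ.sign k) ℤ.∣ k ∣)

  morphism : ℤ.+-*-rawRing -Raw-AlmostCommutative⟶ fromCommutativeRing R
  morphism = record
    { ⟦_⟧    = fromℤ
    ; +-homo = fromℤ-+
    ; *-homo = fromℤ-*
    ; -‿homo = fromℤ-neg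
    ; 0-homo = refl
    ; 1-homo = refl
    }

  _coeff≟_ : ∀ i j → Maybe (fromℤ i ≈ fromℤ j)
  i coeff≟ j with i ℤ.≟ j
  ... | yes ≡.refl = just refl
  ... | no _       = nothing

  open Algebra.Solver.Ring ℤ.+-*-rawRing (fromCommutativeRing R) morphism _coeff≟_ public
    using (solve; con; _:=_; _:+_; _:*_; _:-_; :-_)

-- Constructive order arithmetic and two-sided bounds.

module OrderedFieldProperties {c ℓ₁ ℓ₂ ℓ₃} (K : OrderedField c ℓ₁ ℓ₂ ℓ₃) where
  open OrderedField K
  open CommutativeRing commutativeRing using (semiring)
  open IntegerRingSolver commutativeRing
  open Algebra.Properties.Semiring.Mult semiring using (×-homo-+; ×1-homo-*)

  -- The substitute for trichotomy. Apartness is cotransitive, and an alternative that points the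
  -- wrong way still yields one of the two inequalities by transitivity through `x < y`.
  <-cotrans : ∀ {x y} → x < y → ∀ z → x < z ⊎ z < y
  <-cotrans x<y z with #-cotrans (Equivalence.from #⇔<⊎> (inj₁ x<y)) z
  ... | inj₁ x#z = [ inj₁ , (λ z<x → inj₂ (<-trans z<x x<y)) ]′ (Equivalence.to #⇔<⊎> x#z)
  ... | inj₂ z#y = [ inj₂ , (λ y<z → inj₁ (<-trans x<y y<z)) ]′ (Equivalence.to #⇔<⊎> z#y)

  ≤-reflexive : ∀ {x y} → x ≈ y → x ≤ y
  ≤-reflexive x≈y = <-irrefl (sym x≈y)

  ≤-refl : ∀ {x} → x ≤ x
  ≤-refl = ≤-reflexive refl

  <⇒≤ : ∀ {x y} → x < y → x ≤ y
  <⇒≤ = <-asym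

  ≤-trans : ∀ {x y z} → x ≤ y → y ≤ z → x ≤ z
  ≤-trans {y = y} x≤y y≤z z<x = [ y≤z , x≤y ]′ (<-cotrans z<x y)

  <-≤-trans : ∀ {x y z} → x < y → y ≤ z → x < z
  <-≤-trans {z = z} x<y y≤z = [ (λ x<z → x<z) , flip contradiction y≤z ]′ (<-cotrans x<y z)

  ≤-<-trans : ∀ {x y z} → x ≤ y → y < z → x < z
  ≤-<-trans {x = x} x≤y y<z = [ flip contradiction x≤y , (λ x<z → x<z) ]′ (<-cotrans y<z x)

  ≤-antisym : ∀ {x y} → x ≤ y → y ≤ x → x ≈ y
  ≤-antisym {x} {y} x≤y y≤x = proj₁ (tight x y) λ x#y → [ y≤x , x≤y ]′ (Equivalence.to #⇔<⊎> x#y)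

  ≤-isPreorder : IsPreorder _≈_ _≤_
  ≤-isPreorder = record
    { isEquivalence = isEquivalence
    ; reflexive     = ≤-reflexive
    ; trans         = ≤-trans
    }

  module ≤-Reasoning = Relation.Binary.Reasoning.Base.Triple
    ≤-isPreorder <-asym <-trans <-resp-≈ <⇒≤ <-≤-trans ≤-<-trans
  open ≤-Reasoning

  0<y-x : ∀ {x y} → x < y → 0# < y - x
  0<y-x {x} {y} x<y = begin-strict
    0#     ≈⟨ -‿inverseʳ x ⟨
    x - x  <⟨ +-monoˡ-< (- x) x<y ⟩
    y - x  ∎

  -- Splits an order goal into the positivity of some expression and a ring identity, which is left
  -- to the solver.
  <-by : ∀ {x y d} → 0# < d → y - x ≈ d → x < y
  <-by {x} {y} {d} 0<d y-x≈d = begin-strict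
    x          ≈⟨ +-identityˡ x ⟨
    0# + x     <⟨ +-monoˡ-< x 0<d ⟩
    d + x      ≈⟨ +-congʳ y-x≈d ⟨
    y - x + x  ≈⟨ solve 2 (λ x y → y :- x :+ x := y) refl x y ⟩
    y          ∎

  0≤y-x : ∀ {x y} → x ≤ y → 0# ≤ y - x
  0≤y-x {x} {y} x≤y y-x<0 = x≤y (<-by (0<y-x y-x<0)
    (solve 2 (λ x y → x :- y := con (+ 0) :- (y :- x)) refl x y))

  ≤-by : ∀ {x y d} → 0# ≤ d → y - x ≈ d → x ≤ y
  ≤-by {x} {y} {d} 0≤d y-x≈d y<x = 0≤d (<-by (0<y-x y<x)
    (trans (+-congˡ (-‿cong (sym y-x≈d)))
      (solve 2 (λ x y → con (+ 0) :- (y :- x) := x :- y) refl x y)))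

  +-pos : ∀ {x y} → 0# < x → 0# < y → 0# < x + y
  +-pos {x} {y} 0<x 0<y = <-trans 0<x (<-by 0<y (solve 2 (λ x y → x :+ y :- x := y) refl x y))

  +-nonneg : ∀ {x y} → 0# ≤ x → 0# ≤ y → 0# ≤ x + y
  +-nonneg {x} {y} 0≤x 0≤y = ≤-trans 0≤x (≤-by 0≤y (solve 2 (λ x y → x :+ y :- x := y) refl x y))

  +-mono-≤ : ∀ {x y u v} → x ≤ y → u ≤ v → x + u ≤ y + v
  +-mono-≤ {x} {y} {u} {v} x≤y u≤v = ≤-by (+-nonneg (0≤y-x x≤y) (0≤y-x u≤v))
    (solve 4 (λ x y u v → y :+ v :- (x :+ u) := (y :- x) :+ (v :- u)) refl x y u v)

  +-mono-< : ∀ {x y u v} → x < y → u < v → x + u < y + v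
  +-mono-< {x} {y} {u} {v} x<y u<v = <-by (+-pos (0<y-x x<y) (0<y-x u<v))
    (solve 4 (λ x y u v → y :+ v :- (x :+ u) := (y :- x) :+ (v :- u)) refl x y u v)

  -- Constructively a product is apart from 0 only if its factors are: the
  -- inverse of x y, times y, is an inverse of x.
  xy#0⇒x#0 : ∀ {x y} → x * y # 0# → x # 0#
  xy#0⇒x#0 {x} {y} xy#0 with #⇒invertible xy#0
  ... | w , _ , xy*w≈1 = invertible⇒# (y * w , trans (*-comm _ _) eq , eq)
    where
    eq : (x - 0#) * (y * w) ≈ 1#
    eq = trans (solve 3 (λ x y w → (x :- con (+ 0)) :* (y :* w) := (x :* y :- con (+ 0)) :* w)
                 refl x y w)
               xy*w≈1

  -- A negative product would be apart from `0#`, hence so would both factors; being nonnegative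
  -- they would be positive, and so would the product.
  *-nonneg : ∀ {x y} → 0# ≤ x → 0# ≤ y → 0# ≤ x * y
  *-nonneg {x} {y} 0≤x 0≤y xy<0 = <-asym (*-pos (positive 0≤x x#0) (positive 0≤y y#0)) xy<0
    where
    xy#0 : x * y # 0#
    xy#0 = Equivalence.from #⇔<⊎> (inj₁ xy<0)
    x#0 = xy#0⇒x#0 xy#0
    y#0 = xy#0⇒x#0 (Equivalence.from #⇔<⊎> (inj₁ (proj₂ <-resp-≈ (*-comm x y) xy<0)))
    positive : ∀ {z} → 0# ≤ z → z # 0# → 0# < z
    positive 0≤z z#0 = [ flip contradiction 0≤z , (λ 0<z → 0<z) ]′ (Equivalence.to #⇔<⊎> z#0)

  *-monoʳ-≤ : ∀ {x y z} → 0# ≤ z → x ≤ y → z * x ≤ z * y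
  *-monoʳ-≤ {x} {y} {z} 0≤z x≤y = ≤-by (*-nonneg 0≤z (0≤y-x x≤y))
    (solve 3 (λ x y z → z :* y :- z :* x := z :* (y :- x)) refl x y z)

  *-monoʳ-< : ∀ {x y z} → 0# < z → x < y → z * x < z * y
  *-monoʳ-< {x} {y} {z} 0<z x<y = <-by (*-pos 0<z (0<y-x x<y))
    (solve 3 (λ x y z → z :* y :- z :* x := z :* (y :- x)) refl x y z)

  *-cancelˡ-≤ : ∀ {x y z} → 0# < z → z * x ≤ z * y → x ≤ y
  *-cancelˡ-≤ 0<z zx≤zy y<x = zx≤zy (*-monoʳ-< 0<z y<x)

  /-inverse : ∀ {y} (y#0 : y # 0#) → y * proj₁ (#⇒invertible y#0) ≈ 1#
  /-inverse {y} y#0 with #⇒invertible y#0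
  ... | w , _ , y*w≈1 = trans (*-congʳ (solve 1 (λ y → y := y :- con (+ 0)) refl y)) y*w≈1

  *-/-cancel : ∀ {x y} (y#0 : y # 0#) → y * (x / y ⟨ y#0 ⟩) ≈ x
  *-/-cancel {x} {y} y#0 = begin-equality
    y * (x * w)  ≈⟨ solve 3 (λ x y w → y :* (x :* w) := x :* (y :* w)) refl x y w ⟩
    x * (y * w)  ≈⟨ *-congˡ (/-inverse y#0) ⟩
    x * 1#       ≈⟨ *-identityʳ x ⟩
    x            ∎
    where w = proj₁ (#⇒invertible y#0)

  -- As a factor of a product apart from `0#`, `y` is itself apart from `0#`; excluding `y < 0#`
  -- then leaves the positive case.
  inverse-pos : ∀ {x y} → 0# < x → x * y ≈ 1# → 0# < y
  inverse-pos {x} {y} 0<x xy≈1 =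
    [ flip contradiction ¬y<0 , (λ 0<y → 0<y) ]′ (Equivalence.to #⇔<⊎> y#0)
    where
    ¬y<0 : ¬ (y < 0#)
    ¬y<0 y<0 = <-asym 0<1 (begin-strict
      1#      ≈⟨ xy≈1 ⟨
      x * y   <⟨ *-monoʳ-< 0<x y<0 ⟩
      x * 0#  ≈⟨ zeroʳ x ⟩
      0#      ∎)
    y#0 : y # 0#
    y#0 = xy#0⇒x#0 (Equivalence.from #⇔<⊎>
      (inj₂ (proj₁ <-resp-≈ (trans (sym xy≈1) (*-comm x y)) 0<1)))

  *-cancelˡ-< : ∀ {x y z} → 0# < z → z * x < z * y → x < y
  *-cancelˡ-< {x} {y} {z} 0<z zx<zy = <-by (*-pos 0<w (0<y-x zx<zy)) eq
    where
    z#0 = Equivalence.from #⇔<⊎> (inj₂ 0<z)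
    w = proj₁ (#⇒invertible z#0)
    0<w : 0# < w
    0<w = inverse-pos 0<z (/-inverse z#0)
    eq : y - x ≈ w * (z * y - z * x)
    eq = begin-equality
      y - x                ≈⟨ *-identityˡ (y - x) ⟨
      1# * (y - x)         ≈⟨ *-congʳ (/-inverse z#0) ⟨
      z * w * (y - x)      ≈⟨ solve 4 (λ x y z w → z :* w :* (y :- x) := w :* (z :* y :- z :* x))
                                refl x y z w ⟩
      w * (z * y - z * x)  ∎

  *-cancelˡ-≈ : ∀ {x y z} → 0# < z → z * x ≈ z * y → x ≈ y
  *-cancelˡ-≈ 0<z zx≈zy = ≤-antisym (*-cancelˡ-≤ 0<z (≤-reflexive zx≈zy))
                                    (*-cancelˡ-≤ 0<z (≤-reflexive (sym zx≈zy)))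

  0≤1 : 0# ≤ 1#
  0≤1 = <⇒≤ 0<1

  0≤fromℕ : ∀ n → 0# ≤ fromℕ n
  0≤fromℕ zero    = ≤-refl
  0≤fromℕ (suc n) = <⇒≤ (0<fromℕ-suc n)

  fromℕ-+ : ∀ m n → fromℕ (m ℕ.+ n) ≈ fromℕ m + fromℕ n
  fromℕ-+ = ×-homo-+ 1#

  fromℕ-* : ∀ m n → fromℕ (m ℕ.* n) ≈ fromℕ m * fromℕ n
  fromℕ-* = ×1-homo-*

  half : Carrier → Carrier
  half x = x / fromℕ 2 ⟨ fromℕ#0 2 ⟩

  half+half : ∀ x → half x + half x ≈ x
  half+half x = trans
    (solve 1 (λ h → h :+ h := (con (+ 1) :+ (con (+ 1) :+ con (+ 0))) :* h) refl (half x))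
    (*-/-cancel (fromℕ#0 2))

  half-pos : ∀ {x} → 0# < x → 0# < half x
  half-pos 0<x = *-pos 0<x (inverse-pos (0<fromℕ-suc 1) (/-inverse {fromℕ 2} (fromℕ#0 2)))

  half<x : ∀ {x} → 0# < x → half x < x
  half<x {x} 0<x = <-by (half-pos 0<x)
    (trans (+-congʳ (sym (half+half x))) (solve 1 (λ h → h :+ h :- h := h) refl (half x)))

  -- Constructively there is no minimum; a common lower bound still exists.
  common-lower-bound : ∀ {x y} → 0# < x → 0# < y → ∃[ z ] 0# < z × z ≤ x × z ≤ y
  common-lower-bound {x} {y} 0<x 0<y =
    [ (λ h<y → half x , half-pos 0<x , <⇒≤ (half<x 0<x) , <⇒≤ h<y)
    , (λ y<x → y , 0<y , <⇒≤ y<x , ≤-refl)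
    ]′ (<-cotrans (half<x 0<x) y)

  infix 4 ∣_∣≤_

  -- Unlike `∣_∣<_`, this form passes to limits and allows the radius `0#`.
  ∣_∣≤_ : Carrier → Carrier → Set ℓ₃
  ∣ x ∣≤ r = (- r ≤ x) × (x ≤ r)

  ∣∣≤-resp : ∀ {x y r s} → x ≈ y → r ≈ s → ∣ x ∣≤ r → ∣ y ∣≤ s
  ∣∣≤-resp {x} {y} {r} {s} x≈y r≈s (-r≤x , x≤r) =
    (begin - s ≈⟨ -‿cong r≈s ⟨ - r ≤⟨ -r≤x ⟩ x ≈⟨ x≈y ⟩ y ∎) ,
    (begin y ≈⟨ x≈y ⟨ x ≤⟨ x≤r ⟩ r ≈⟨ r≈s ⟩ s ∎)

  ∣∣<-resp : ∀ {x y r s} → x ≈ y → r ≈ s → ∣ x ∣< r → ∣ y ∣< s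
  ∣∣<-resp {x} {y} {r} {s} x≈y r≈s (-r<x , x<r) =
    (begin-strict - s ≈⟨ -‿cong r≈s ⟨ - r <⟨ -r<x ⟩ x ≈⟨ x≈y ⟩ y ∎) ,
    (begin-strict y ≈⟨ x≈y ⟨ x <⟨ x<r ⟩ r ≈⟨ r≈s ⟩ s ∎)

  neg-mono-≤ : ∀ {x y} → x ≤ y → - y ≤ - x
  neg-mono-≤ {x} {y} x≤y = ≤-by (0≤y-x x≤y) (solve 2 (λ x y → (:- x) :- (:- y) := y :- x) refl x y)

  neg-mono-< : ∀ {x y} → x < y → - y < - x
  neg-mono-< {x} {y} x<y = <-by (0<y-x x<y) (solve 2 (λ x y → (:- x) :- (:- y) := y :- x) refl x y)

  ∣∣≤-weaken : ∀ {x r s} → r ≤ s → ∣ x ∣≤ r → ∣ x ∣≤ s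
  ∣∣≤-weaken r≤s (-r≤x , x≤r) = ≤-trans (neg-mono-≤ r≤s) -r≤x , ≤-trans x≤r r≤s

  ∣∣<⇒∣∣≤ : ∀ {x r} → ∣ x ∣< r → ∣ x ∣≤ r
  ∣∣<⇒∣∣≤ (-r<x , x<r) = <⇒≤ -r<x , <⇒≤ x<r

  ∣∣≤-<-trans : ∀ {x r s} → ∣ x ∣≤ r → r < s → ∣ x ∣< s
  ∣∣≤-<-trans (-r≤x , x≤r) r<s = <-≤-trans (neg-mono-< r<s) -r≤x , ≤-<-trans x≤r r<s

  ∣∣≤-neg : ∀ {x r} → ∣ x ∣≤ r → ∣ - x ∣≤ r
  ∣∣≤-neg {x} {r} (-r≤x , x≤r) = neg-mono-≤ x≤r ,
    (begin - x ≤⟨ neg-mono-≤ -r≤x ⟩ - - r ≈⟨ solve 1 (λ r → :- (:- r) := r) refl r ⟩ r ∎)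

  ∣∣<-neg : ∀ {x r} → ∣ x ∣< r → ∣ - x ∣< r
  ∣∣<-neg {x} {r} (-r<x , x<r) = neg-mono-< x<r ,
    (begin-strict - x <⟨ neg-mono-< -r<x ⟩ - - r ≈⟨ solve 1 (λ r → :- (:- r) := r) refl r ⟩ r ∎)

  ∣∣≤-+ : ∀ {x y r s} → ∣ x ∣≤ r → ∣ y ∣≤ s → ∣ x + y ∣≤ r + s
  ∣∣≤-+ {x} {y} {r} {s} (-r≤x , x≤r) (-s≤y , y≤s) =
    (begin - (r + s) ≈⟨ solve 2 (λ r s → :- (r :+ s) := (:- r) :+ (:- s)) refl r s ⟩
           - r - s ≤⟨ +-mono-≤ -r≤x -s≤y ⟩ x + y ∎) ,
    +-mono-≤ x≤r y≤s

  ∣∣≤⇒0≤ : ∀ {x r} → ∣ x ∣≤ r → 0# ≤ r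
  ∣∣≤⇒0≤ {x} {r} (-r≤x , x≤r) r<0 = ≤-trans -r≤x x≤r (begin-strict
    r       <⟨ r<0 ⟩
    0#      ≈⟨ solve 0 (con (+ 0) := :- con (+ 0)) refl ⟩
    - 0#    <⟨ neg-mono-< r<0 ⟩
    - r     ∎)

  -- 2 (r s - x y) = (r - x) (s + y) + (r + x) (s - y)
  *-upper : ∀ {x y r s} → ∣ x ∣≤ r → ∣ y ∣≤ s → x * y ≤ r * s
  *-upper {x} {y} {r} {s} (-r≤x , x≤r) (-s≤y , y≤s) =
    *-cancelˡ-≤ (0<fromℕ-suc 1) (≤-by
      (+-nonneg (*-nonneg (0≤y-x x≤r) (0≤y-x -s≤y)) (*-nonneg (0≤y-x -r≤x) (0≤y-x y≤s)))
      (solve 4 (λ x y r s →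
          let two = con (+ 1) :+ (con (+ 1) :+ con (+ 0)) in
          two :* (r :* s) :- two :* (x :* y)
            := (r :- x) :* (y :- (:- s)) :+ (x :- (:- r)) :* (s :- y))
        refl x y r s))

  ∣∣≤-* : ∀ {x y r s} → ∣ x ∣≤ r → ∣ y ∣≤ s → ∣ x * y ∣≤ r * s
  ∣∣≤-* {x} {y} {r} {s} ∣x∣≤r ∣y∣≤s =
    (begin - (r * s) ≤⟨ neg-mono-≤ (*-upper (∣∣≤-neg ∣x∣≤r) ∣y∣≤s) ⟩
           - (- x * y) ≈⟨ solve 2 (λ x y → :- ((:- x) :* y) := x :* y) refl x y ⟩ x * y ∎) ,
    *-upper ∣x∣≤r ∣y∣≤s

  0≤⇒∣∣≤ : ∀ {x} → 0# ≤ x → ∣ x ∣≤ x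
  0≤⇒∣∣≤ {x} 0≤x =
    ≤-by (+-nonneg 0≤x 0≤x) (solve 1 (λ x → x :- (:- x) := x :+ x) refl x) , ≤-refl

  ∣0∣≤ : ∀ {r} → 0# ≤ r → ∣ 0# ∣≤ r
  ∣0∣≤ {r} 0≤r = ∣∣≤-weaken 0≤r (0≤⇒∣∣≤ ≤-refl)

-- Limits of sequences.

module Limits {c ℓ₁ ℓ₂ ℓ₃} (ℝ : RealNumbers c ℓ₁ ℓ₂ ℓ₃) where
  open RealNumbers ℝ
  open OrderedFieldProperties orderedField
  open IntegerRingSolver commutativeRing
  open ≤-Reasoning

  -- The sum of Archimedean bounds for `x` and `- x` stands in for their maximum, and the extra `1#`
  -- makes it strictly positive.
  bounded : ∀ x → ∃[ b ] 0# < b × ∣ x ∣≤ b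
  bounded x = b , ≤-<-trans (+-nonneg (0≤fromℕ m) (0≤fromℕ n)) n+m<b ,
    (begin
      - b              ≤⟨ neg-mono-≤ (<⇒≤ n+m<b) ⟩
      - (M + N)        ≤⟨ neg-mono-≤ (+-mono-≤ (<⇒≤ (proj₂ (archimedean (- x)))) (0≤fromℕ n)) ⟩
      - (- x + 0#)     ≈⟨ solve 1 (λ x → :- ((:- x) :+ con (+ 0)) := x) refl x ⟩
      x                ∎) ,
    (begin
      x                ≈⟨ +-identityˡ x ⟨
      0# + x           ≤⟨ +-mono-≤ (0≤fromℕ m) (<⇒≤ (proj₂ (archimedean x))) ⟩
      M + N            ≤⟨ <⇒≤ n+m<b ⟩
      b                ∎)
    where
    m = proj₁ (archimedean (- x))
    n = proj₁ (archimedean x)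
    M = fromℕ m
    N = fromℕ n
    b = M + N + 1#
    n+m<b : M + N < b
    n+m<b = <-by 0<1 (solve 2 (λ a e → a :+ e :- a := e) refl (M + N) 1#)

  -- The cap `η ≤ 1#` serves to absorb `η * η` into `η` and to enter the estimates of cosine and
  -- sine near `0#`. Aiming at `half ε` keeps the final inequality strict.
  rescale : ∀ {ε M} → 0# < ε → 0# < M → ∃[ η ] 0# < η × η ≤ 1# × M * η < ε
  rescale {ε} {M} 0<ε 0<M = η , 0<η , η≤1 , (begin-strict
    M * η    ≤⟨ *-monoʳ-≤ (<⇒≤ 0<M) η≤h ⟩
    M * h    ≈⟨ *-/-cancel M#0 ⟩
    half ε   <⟨ half<x 0<ε ⟩
    ε        ∎)
    where
    M#0 = Equivalence.from #⇔<⊎> (inj₂ 0<M)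
    h = half ε / M ⟨ M#0 ⟩
    0<h : 0# < h
    0<h = *-pos (half-pos 0<ε) (inverse-pos 0<M (/-inverse M#0))
    lb = common-lower-bound 0<h 0<1
    η = proj₁ lb
    0<η = proj₁ (proj₂ lb)
    η≤h = proj₁ (proj₂ (proj₂ lb))
    η≤1 = proj₂ (proj₂ (proj₂ lb))

  ⟶-const : ∀ l → (λ _ → l) ⟶ l
  ⟶-const l ε 0<ε = 0 , λ _ _ →
    ∣∣≤-<-trans (∣∣≤-resp (sym (-‿inverseʳ l)) refl (∣0∣≤ ≤-refl)) 0<ε

  ⟶-resp-≈ : ∀ {s t l m} → (∀ n → s n ≈ t n) → l ≈ m → s ⟶ l → t ⟶ m
  ⟶-resp-≈ s≈t l≈m s⟶l ε 0<ε = proj₁ (s⟶l ε 0<ε) , λ n N≤n →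
    ∣∣<-resp (+-cong (s≈t n) (-‿cong l≈m)) refl (proj₂ (s⟶l ε 0<ε) n N≤n)

  ⟶-subsequence : ∀ {s l} (φ : ℕ → ℕ) → (∀ n → n ℕ.≤ φ n) → s ⟶ l → (s ∘ φ) ⟶ l
  ⟶-subsequence φ n≤φn s⟶l ε 0<ε = proj₁ (s⟶l ε 0<ε) , λ n N≤n →
    proj₂ (s⟶l ε 0<ε) (φ n) (ℕ.≤-trans N≤n (n≤φn n))

  eventually₂ : ∀ {s t l m} → s ⟶ l → t ⟶ m → ∀ ε → 0# < ε →
    ∃[ N ] ∀ n → N ℕ.≤ n → ∣ s n - l ∣< ε × ∣ t n - m ∣< ε
  eventually₂ s⟶l t⟶m ε 0<ε = M ℕ.+ N , λ n M+N≤n →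
    proj₂ (s⟶l ε 0<ε) n (ℕ.≤-trans (ℕ.m≤m+n M N) M+N≤n) ,
    proj₂ (t⟶m ε 0<ε) n (ℕ.≤-trans (ℕ.m≤n+m N M) M+N≤n)
    where
    M = proj₁ (s⟶l ε 0<ε)
    N = proj₁ (t⟶m ε 0<ε)

  -- If `m < l`, an index at which both sequences are within half the gap of their limits would put
  -- `t` strictly below `s`.
  ⟶-≤ : ∀ {s t l m} → (∀ n → s n ≤ t n) → s ⟶ l → t ⟶ m → l ≤ m
  ⟶-≤ {s} {t} {l} {m} s≤t s⟶l t⟶m m<l = s≤t N (<-by (+-pos (0<y-x -ε<s-l) (0<y-x t-m<ε)) eq)
    where
    ε = half (l - m)
    0<l-m = 0<y-x m<l
    close = eventually₂ s⟶l t⟶m ε (half-pos 0<l-m)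
    N = proj₁ close
    -ε<s-l = proj₁ (proj₁ (proj₂ close N ℕ.≤-refl))
    t-m<ε = proj₂ (proj₂ (proj₂ close N ℕ.≤-refl))
    eq : s N - t N ≈ s N - l - - ε + (ε - (t N - m))
    eq = begin-equality
      s N - t N
        ≈⟨ solve 4 (λ s t l m → s :- t := s :- l :- (t :- m) :+ (l :- m)) refl (s N) (t N) l m ⟩
      s N - l - (t N - m) + (l - m)
        ≈⟨ +-congˡ (half+half (l - m)) ⟨
      s N - l - (t N - m) + (ε + ε)
        ≈⟨ solve 5 (λ s t l m ε → s :- l :- (t :- m) :+ (ε :+ ε)
                                    := s :- l :- (:- ε) :+ (ε :- (t :- m)))
             refl (s N) (t N) l m ε ⟩
      s N - l - - ε + (ε - (t N - m))
        ∎

  ⟶-unique : ∀ {s l m} → s ⟶ l → s ⟶ m → l ≈ m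
  ⟶-unique s⟶l s⟶m = ≤-antisym (⟶-≤ (λ _ → ≤-refl) s⟶l s⟶m) (⟶-≤ (λ _ → ≤-refl) s⟶m s⟶l)

  ⟶-∣∣≤ : ∀ {s l b} → (∀ n → ∣ s n ∣≤ b) → s ⟶ l → ∣ l ∣≤ b
  ⟶-∣∣≤ {b = b} ∣s∣≤b s⟶l =
    ⟶-≤ (proj₁ ∘ ∣s∣≤b) (⟶-const (- b)) s⟶l , ⟶-≤ (proj₂ ∘ ∣s∣≤b) s⟶l (⟶-const b)

  ⟶-squeeze : ∀ {s t} → (∀ n → ∣ s n ∣≤ t n) → t ⟶ 0# → s ⟶ 0#
  ⟶-squeeze {s} {t} ∣s∣≤t t⟶0 ε 0<ε = proj₁ (t⟶0 ε 0<ε) , λ n N≤n →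
    ∣∣≤-<-trans (∣∣≤-resp (x≈x-0 (s n)) (x≈x-0 (t n)) (∣s∣≤t n))
      (proj₂ (proj₂ (t⟶0 ε 0<ε) n N≤n))
    where
    x≈x-0 : ∀ x → x ≈ x - 0#
    x≈x-0 = solve 1 (λ x → x := x :- con (+ 0)) refl

  ⟶-+ : ∀ {s t l m} → s ⟶ l → t ⟶ m → (λ n → s n + t n) ⟶ l + m
  ⟶-+ {s} {t} {l} {m} s⟶l t⟶m ε 0<ε = proj₁ close , λ n N≤n →
    let (a , b) , (u , v) = proj₂ close n N≤n in
    ∣∣<-resp (solve 4 (λ s t l m → s :- l :+ (t :- m) := s :+ t :- (l :+ m)) refl (s n) (t n) l m)
      (half+half ε)
      ( (begin-strict
          - (half ε + half ε)  ≈⟨ solve 1 (λ h → :- (h :+ h) := (:- h) :+ (:- h)) refl (half ε) ⟩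
          - half ε - half ε    <⟨ +-mono-< a u ⟩
          s n - l + (t n - m)  ∎)
      , +-mono-< b v)
    where close = eventually₂ s⟶l t⟶m (half ε) (half-pos 0<ε)

  ⟶-neg : ∀ {s l} → s ⟶ l → (λ n → - s n) ⟶ - l
  ⟶-neg {s} {l} s⟶l ε 0<ε = proj₁ (s⟶l ε 0<ε) , λ n N≤n →
    ∣∣<-resp (solve 2 (λ s l → :- (s :- l) := (:- s) :- (:- l)) refl (s n) l) refl
      (∣∣<-neg (proj₂ (s⟶l ε 0<ε) n N≤n))

  ⟶-* : ∀ {s t l m} → s ⟶ l → t ⟶ m → (λ n → s n * t n) ⟶ l * m
  ⟶-* {s} {t} {l} {m} s⟶l t⟶m ε 0<ε = proj₁ close , λ n N≤n →
    let ds , dt = proj₂ close n N≤n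
        ∣ds∣≤η = ∣∣<⇒∣∣≤ ds
        ∣dt∣≤η = ∣∣<⇒∣∣≤ dt
    in ∣∣≤-<-trans
      (∣∣≤-weaken (bound ∣ds∣≤η)
        (∣∣≤-resp
          (solve 4 (λ s t l m → (s :- l) :* (t :- m) :+ ((s :- l) :* m :+ l :* (t :- m))
                                  := s :* t :- l :* m)
            refl (s n) (t n) l m)
          refl
          (∣∣≤-+ (∣∣≤-* ∣ds∣≤η ∣dt∣≤η) (∣∣≤-+ (∣∣≤-* ∣ds∣≤η ∣m∣≤b) (∣∣≤-* ∣l∣≤a ∣dt∣≤η)))))
      Mη<ε
    where
    a = proj₁ (bounded l)
    b = proj₁ (bounded m)
    ∣l∣≤a = proj₂ (proj₂ (bounded l))
    ∣m∣≤b = proj₂ (proj₂ (bounded m))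
    -- The error is `ds * dt + (ds * m + l * dt)`; the three summands contribute `1#` (as
    -- `η * η ≤ η`), `b` and `a`.
    M = 1# + (b + a)
    0<M : 0# < M
    0<M = +-pos 0<1 (+-pos (proj₁ (proj₂ (bounded m))) (proj₁ (proj₂ (bounded l))))
    scaled = rescale 0<ε 0<M
    η = proj₁ scaled
    0<η = proj₁ (proj₂ scaled)
    η≤1 = proj₁ (proj₂ (proj₂ scaled))
    Mη<ε = proj₂ (proj₂ (proj₂ scaled))
    close = eventually₂ s⟶l t⟶m η 0<η
    bound : ∀ {x} → ∣ x ∣≤ η → η * η + (η * b + a * η) ≤ M * η
    bound ∣x∣≤η = ≤-by (*-nonneg (∣∣≤⇒0≤ ∣x∣≤η) (0≤y-x η≤1))
      (solve 3 (λ a b η → (con (+ 1) :+ (b :+ a)) :* η :- (η :* η :+ (η :* b :+ a :* η))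
                            := η :* (con (+ 1) :- η))
        refl a b η)

-- Partial sums and comparison with a majorant.

module Series {c ℓ₁ ℓ₂ ℓ₃} (ℝ : RealNumbers c ℓ₁ ℓ₂ ℓ₃) where
  open RealNumbers ℝ
  open Analysis ℝ using (partialSums)
  open OrderedFieldProperties orderedField
  open IntegerRingSolver commutativeRing
  open Limits ℝ
  open ≤-Reasoning

  partialSums-cong : ∀ {s t} → (∀ k → s k ≈ t k) → ∀ n → partialSums s n ≈ partialSums t n
  partialSums-cong s≈t zero    = refl
  partialSums-cong s≈t (suc n) = +-cong (partialSums-cong s≈t n) (s≈t n)

  partialSums-+ : ∀ s t n → partialSums (λ k → s k + t k) n ≈ partialSums s n + partialSums t n
  partialSums-+ s t zero    = sym (+-identityˡ 0#)
  partialSums-+ s t (suc n) = trans (+-congʳ (partialSums-+ s t n))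
    (solve 4 (λ S T a b → S :+ T :+ (a :+ b) := S :+ a :+ (T :+ b)) refl
      (partialSums s n) (partialSums t n) (s n) (t n))

  partialSums-*ˡ : ∀ x s n → partialSums (λ k → x * s k) n ≈ x * partialSums s n
  partialSums-*ˡ x s zero    = sym (zeroʳ x)
  partialSums-*ˡ x s (suc n) = trans (+-congʳ (partialSums-*ˡ x s n)) (sym (distribˡ x _ _))

  partialSums-*ʳ : ∀ x s n → partialSums (λ k → s k * x) n ≈ partialSums s n * x
  partialSums-*ʳ x s zero    = sym (zeroˡ x)
  partialSums-*ʳ x s (suc n) = trans (+-congʳ (partialSums-*ʳ x s n)) (sym (distribʳ x _ _))

  partialSums-neg : ∀ s n → partialSums (λ k → - s k) n ≈ - partialSums s n
  partialSums-neg s zero    = solve 0 (con (+ 0) := :- con (+ 0)) refl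
  partialSums-neg s (suc n) = trans (+-congʳ (partialSums-neg s n))
    (solve 2 (λ S a → (:- S) :+ (:- a) := :- (S :+ a)) refl (partialSums s n) (s n))

  partialSums-front : ∀ s n → partialSums s (suc n) ≈ s 0 + partialSums (s ∘ suc) n
  partialSums-front s zero    = +-comm 0# (s 0)
  partialSums-front s (suc n) = trans (+-congʳ (partialSums-front s n)) (+-assoc _ _ _)

  Nonneg : (ℕ → Carrier) → Set ℓ₃
  Nonneg s = ∀ k → 0# ≤ s k

  partialSums-increases : ∀ {s} → Nonneg s → ∀ d n → partialSums s n ≤ partialSums s (d ℕ.+ n)
  partialSums-increases         0≤s zero    n = ≤-refl
  partialSums-increases {s = s} 0≤s (suc d) n = ≤-trans (partialSums-increases 0≤s d n)
    (≤-by (0≤s (d ℕ.+ n))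
      (solve 2 (λ S a → S :+ a :- S := a) refl (partialSums s (d ℕ.+ n)) (s (d ℕ.+ n))))

  partialSums-mono : ∀ {s} → Nonneg s → ∀ {m n} → m ℕ.≤ n → partialSums s m ≤ partialSums s n
  partialSums-mono {s} 0≤s {m} {n} m≤n =
    ≡.subst (λ k → partialSums s m ≤ partialSums s k) (ℕ.m∸n+n≡m m≤n)
      (partialSums-increases 0≤s (n ℕ.∸ m) m)

  Dominates : (t s : ℕ → Carrier) → Set ℓ₃
  Dominates t s = ∀ k → ∣ s k ∣≤ t k

  partialSums-dominated : ∀ {s t} → Dominates t s → ∀ {m n} → m ℕ.≤ n →
    ∣ partialSums s n - partialSums s m ∣≤ (partialSums t n - partialSums t m)
  partialSums-dominated {s} {t} ∣s∣≤t {m} {n} m≤n =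
    ≡.subst (λ k → ∣ partialSums s k - partialSums s m ∣≤ (partialSums t k - partialSums t m))
      (ℕ.m∸n+n≡m m≤n) (go (n ℕ.∸ m))
    where
    shift : ∀ S a T → S - T + a ≈ S + a - T
    shift = solve 3 (λ S a T → S :- T :+ a := S :+ a :- T) refl
    go : ∀ d → ∣ partialSums s (d ℕ.+ m) - partialSums s m ∣≤
               (partialSums t (d ℕ.+ m) - partialSums t m)
    go zero    = ∣∣≤-resp (sym (-‿inverseʳ _)) (sym (-‿inverseʳ _)) (∣0∣≤ ≤-refl)
    go (suc d) = ∣∣≤-resp (shift _ _ _) (shift _ _ _) (∣∣≤-+ (go d) (∣s∣≤t (d ℕ.+ m)))

  -- Comparison test: a block of `s` is bounded by the same block of `t`, so one `N` serves both.
  IsCauchy-dominated : ∀ {s t} → Dominates t s → IsCauchy (partialSums t) → IsCauchy (partialSums s)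
  IsCauchy-dominated {s} {t} ∣s∣≤t cauchy ε 0<ε = N , λ m n N≤m N≤n →
    [ (λ m≤n → ∣∣<-resp (flip-sub _ _) refl
        (∣∣<-neg (∣∣≤-<-trans (partialSums-dominated ∣s∣≤t m≤n) (proj₂ (close n m N≤n N≤m)))))
    , (λ n≤m → ∣∣≤-<-trans (partialSums-dominated ∣s∣≤t n≤m) (proj₂ (close m n N≤m N≤n)))
    ]′ (ℕ.≤-total m n)
    where
    N = proj₁ (cauchy ε 0<ε)
    close = proj₂ (cauchy ε 0<ε)
    flip-sub : ∀ x y → - (x - y) ≈ y - x
    flip-sub = solve 2 (λ x y → :- (x :- y) := y :- x) refl

  IsCauchy-resp-≈ : ∀ {s t} → (∀ n → s n ≈ t n) → IsCauchy s → IsCauchy t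
  IsCauchy-resp-≈ s≈t cauchy ε 0<ε = proj₁ (cauchy ε 0<ε) , λ m n N≤m N≤n →
    ∣∣<-resp (+-cong (s≈t m) (-‿cong (s≈t n))) refl (proj₂ (cauchy ε 0<ε) m n N≤m N≤n)

  -- Double sums over squares and triangles.

  rectangle : ℕ → ℕ → (ℕ → ℕ → Carrier) → Carrier
  rectangle m n a = partialSums (λ i → partialSums (a i) n) m

  -- The sum over `i + j = k`. Peeling off `i = 0` and shifting the rows avoids the truncated
  -- subtraction `k ∸ i`.
  diagonal : ℕ → (ℕ → ℕ → Carrier) → Carrier
  diagonal zero    a = a 0 0
  diagonal (suc k) a = a 0 (suc k) + diagonal k (a ∘ suc)

  triangle : ℕ → (ℕ → ℕ → Carrier) → Carrier
  triangle n a = partialSums (λ k → diagonal k a) n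

  diagonal-cong : ∀ {a b} → (∀ i j → a i j ≈ b i j) → ∀ k → diagonal k a ≈ diagonal k b
  diagonal-cong a≈b zero    = a≈b 0 0
  diagonal-cong a≈b (suc k) = +-cong (a≈b 0 (suc k)) (diagonal-cong (λ i → a≈b (suc i)) k)

  diagonal-+ : ∀ a b k → diagonal k (λ i j → a i j + b i j) ≈ diagonal k a + diagonal k b
  diagonal-+ a b zero    = refl
  diagonal-+ a b (suc k) = trans (+-congˡ (diagonal-+ (a ∘ suc) (b ∘ suc) k))
    (solve 4 (λ x y S T → x :+ y :+ (S :+ T) := x :+ S :+ (y :+ T)) refl
      (a 0 (suc k)) (b 0 (suc k)) (diagonal k (a ∘ suc)) (diagonal k (b ∘ suc)))

  diagonal-weighted : ∀ (σ : ℕ → Carrier) a k →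
    diagonal k (λ i j → σ (i ℕ.+ j) * a i j) ≈ σ k * diagonal k a
  diagonal-weighted σ a zero    = refl
  diagonal-weighted σ a (suc k) =
    trans (+-congˡ (diagonal-weighted (σ ∘ suc) (a ∘ suc) k)) (sym (distribˡ _ _ _))

  -- Peels off the end `j = 0`, opposite to the recursion; a weight `j` vanishes there.
  diagonal-back : ∀ a k → diagonal (suc k) a ≈ diagonal k (λ i j → a i (suc j)) + a (suc k) 0
  diagonal-back a zero    = refl
  diagonal-back a (suc k) = trans (+-congˡ (diagonal-back (a ∘ suc) k)) (sym (+-assoc _ _ _))

  -- Cuts the triangle by rows instead of diagonals, so that it can be compared with a rectangle by
  -- induction on the rows.
  triangle-front : ∀ a n → triangle (suc n) a ≈ partialSums (a 0) (suc n) + triangle n (a ∘ suc)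
  triangle-front a n = begin-equality
    triangle (suc n) a
      ≈⟨ partialSums-front _ n ⟩
    a 0 0 + partialSums (λ k → a 0 (suc k) + diagonal k (a ∘ suc)) n
      ≈⟨ +-congˡ (partialSums-+ _ _ n) ⟩
    a 0 0 + (partialSums (a 0 ∘ suc) n + triangle n (a ∘ suc))
      ≈⟨ +-assoc _ _ _ ⟨
    a 0 0 + partialSums (a 0 ∘ suc) n + triangle n (a ∘ suc)
      ≈⟨ +-congʳ (partialSums-front (a 0) n) ⟨
    partialSums (a 0) (suc n) + triangle n (a ∘ suc)
      ∎

  rectangle-product : ∀ s t m n → rectangle m n (λ i j → s i * t j) ≈ partialSums s m * partialSums t n
  rectangle-product s t m n = trans
    (partialSums-cong (λ i → partialSums-*ˡ (s i) t n) m)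
    (partialSums-*ʳ (partialSums t n) s m)

  rectangle-+ : ∀ a b m n → rectangle m n (λ i j → a i j + b i j) ≈ rectangle m n a + rectangle m n b
  rectangle-+ a b m n = trans (partialSums-cong (λ i → partialSums-+ (a i) (b i) n) m)
                              (partialSums-+ _ _ m)

  rectangle-cong : ∀ {a b} → (∀ i j → a i j ≈ b i j) → ∀ m n → rectangle m n a ≈ rectangle m n b
  rectangle-cong a≈b m n = partialSums-cong (λ i → partialSums-cong (a≈b i) n) m

  -- Since `m ≤ n`, the triangle lies in the rectangle. What row 0 has outside the triangle is a
  -- block of a dominated series, and the remaining rows form a smaller instance.
  rectangle-triangle : ∀ {a b} → (∀ i → Dominates (b i) (a i)) → ∀ {m n} → m ℕ.≤ n →
    ∣ rectangle m n a - triangle m a ∣≤ (rectangle m n b - triangle m b)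
  rectangle-triangle         ∣a∣≤b {zero}  {n} m≤n =
    ∣∣≤-resp (sym (-‿inverseʳ _)) (sym (-‿inverseʳ _)) (∣0∣≤ ≤-refl)
  rectangle-triangle {a} {b} ∣a∣≤b {suc m} {n} m<n =
    ∣∣≤-resp (split a) (split b)
      (∣∣≤-+ (partialSums-dominated (∣a∣≤b 0) m<n)
             (rectangle-triangle (∣a∣≤b ∘ suc) (ℕ.<⇒≤ m<n)))
    where
    split : ∀ a → partialSums (a 0) n - partialSums (a 0) (suc m)
                    + (rectangle m n (a ∘ suc) - triangle m (a ∘ suc))
                  ≈ rectangle (suc m) n a - triangle (suc m) a
    split a = begin-equality
      partialSums (a 0) n - partialSums (a 0) (suc m) + (rectangle m n (a ∘ suc) - triangle m (a ∘ suc))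
        ≈⟨ solve 4 (λ P Q R T → P :- Q :+ (R :- T) := P :+ R :- (Q :+ T)) refl _ _ _ _ ⟩
      partialSums (a 0) n + rectangle m n (a ∘ suc) - (partialSums (a 0) (suc m) + triangle m (a ∘ suc))
        ≈⟨ +-cong (partialSums-front _ m) (-‿cong (triangle-front a m)) ⟨
      rectangle (suc m) n a - triangle (suc m) a
        ∎

  -- Indices `i < m` and `j < n` satisfy `i + j < m + n`, so the rectangle is part of that triangle
  -- and the other terms only add.
  rectangle≤triangle : ∀ {b} → (∀ i → Nonneg (b i)) → ∀ m n → rectangle m n b ≤ triangle (m ℕ.+ n) b
  rectangle≤triangle {b} 0≤b zero    n = partialSums-mono (diagonal-nonneg 0≤b) {0} {n} ℕ.z≤n
    where
    diagonal-nonneg : ∀ {b} → (∀ i → Nonneg (b i)) → ∀ k → 0# ≤ diagonal k b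
    diagonal-nonneg 0≤b zero    = 0≤b 0 0
    diagonal-nonneg 0≤b (suc k) = +-nonneg (0≤b 0 (suc k)) (diagonal-nonneg (0≤b ∘ suc) k)
  rectangle≤triangle {b} 0≤b (suc m) n = begin
    rectangle (suc m) n b
      ≈⟨ partialSums-front _ m ⟩
    partialSums (b 0) n + rectangle m n (b ∘ suc)
      ≤⟨ +-mono-≤ (partialSums-mono (0≤b 0) (ℕ.m≤n+m n (suc m)))
                  (rectangle≤triangle (0≤b ∘ suc) m n) ⟩
    partialSums (b 0) (suc (m ℕ.+ n)) + triangle (m ℕ.+ n) (b ∘ suc)
      ≈⟨ triangle-front b (m ℕ.+ n) ⟨
    triangle (suc m ℕ.+ n) b
      ∎

  -- The part of the square outside the triangle lies in the larger triangle
  -- of the majorant, so it is squeezed by a difference of Cauchy terms.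
  square-triangle⟶0 : ∀ {a b} → (∀ i → Dominates (b i) (a i)) → IsCauchy (λ n → triangle n b) →
    (λ n → rectangle n n a - triangle n a) ⟶ 0#
  square-triangle⟶0 {a} {b} ∣a∣≤b cauchy =
    ⟶-squeeze
      (λ n → ∣∣≤-weaken (+-mono-≤ (rectangle≤triangle (λ i j → ∣∣≤⇒0≤ (∣a∣≤b i j)) n n) ≤-refl)
               (rectangle-triangle {a} {b} ∣a∣≤b {n} ℕ.≤-refl))
      λ ε 0<ε → proj₁ (cauchy ε 0<ε) , λ n N≤n →
        ∣∣<-resp (solve 1 (λ x → x := x :- con (+ 0)) refl _) refl
          (proj₂ (cauchy ε 0<ε) (n ℕ.+ n) n (ℕ.≤-trans N≤n (ℕ.m≤m+n n n)) N≤n)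

  -- Terms of the exponential series and the binomial theorem.

  expTerm : Carrier → ℕ → Carrier
  expTerm x k = x ^ k / fromℕ (k !) ⟨ fromℕ#0 (k !) {{k ℕ.!≢0}} ⟩

  1/k! : ℕ → Carrier
  1/k! k = proj₁ (#⇒invertible (fromℕ#0 (k !) {{k ℕ.!≢0}}))

  k!*1/k! : ∀ k → fromℕ (k !) * 1/k! k ≈ 1#
  k!*1/k! k = /-inverse (fromℕ#0 (k !) {{k ℕ.!≢0}})

  0<1/k! : ∀ k → 0# < 1/k! k
  0<1/k! k = inverse-pos (0<k! (k !) {{k ℕ.!≢0}}) (k!*1/k! k)
    where
    0<k! : ∀ n .{{_ : NonZero n}} → 0# < fromℕ n
    0<k! (suc n) = 0<fromℕ-suc n

  expTerm-zero : ∀ x → expTerm x 0 ≈ 1#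
  expTerm-zero x = begin-equality
    1# * 1/k! 0          ≈⟨ *-congʳ (+-identityʳ 1#) ⟨
    fromℕ 1 * 1/k! 0     ≈⟨ k!*1/k! 0 ⟩
    1#                   ∎

  -- Clears the factorials: the binomial theorem and the halving of the tail terms rest on this
  -- recurrence. Inserting `k! · 1/k!` completes `suc k` to the factorial that `1/k! (suc k)`
  -- cancels.
  expTerm-suc : ∀ x k → fromℕ (suc k) * expTerm x (suc k) ≈ x * expTerm x k
  expTerm-suc x k = begin-equality
    s * (x * p * v)            ≈⟨ *-identityʳ _ ⟨
    s * (x * p * v) * 1#       ≈⟨ *-congˡ (k!*1/k! k) ⟨
    s * (x * p * v) * (f * u)
      ≈⟨ solve 6 (λ s x p v f u → s :* (x :* p :* v) :* (f :* u) := x :* (p :* u) :* (s :* f :* v))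
           refl s x p v f u ⟩
    x * (p * u) * (s * f * v)  ≈⟨ *-congˡ (*-congʳ (fromℕ-* (suc k) (k !))) ⟨
    x * (p * u) * (fromℕ (suc k !) * v)  ≈⟨ *-congˡ (k!*1/k! (suc k)) ⟩
    x * (p * u) * 1#           ≈⟨ *-identityʳ _ ⟩
    x * (p * u)                ∎
    where
    s = fromℕ (suc k)
    p = x ^ k
    u = 1/k! k
    v = 1/k! (suc k)
    f = fromℕ (k !)

  expTerm-one : ∀ x → expTerm x 1 ≈ x
  expTerm-one x = begin-equality
    expTerm x 1                ≈⟨ *-identityˡ _ ⟨
    1# * expTerm x 1           ≈⟨ *-congʳ (+-identityʳ 1#) ⟨
    fromℕ 1 * expTerm x 1      ≈⟨ expTerm-suc x 0 ⟩
    x * expTerm x 0            ≈⟨ *-congˡ (expTerm-zero x) ⟩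
    x * 1#                     ≈⟨ *-identityʳ x ⟩
    x                          ∎

  ^-cong : ∀ {x y} → x ≈ y → ∀ k → x ^ k ≈ y ^ k
  ^-cong x≈y zero    = refl
  ^-cong x≈y (suc k) = *-cong x≈y (^-cong x≈y k)

  expTerm-cong : ∀ {x y} → x ≈ y → ∀ k → expTerm x k ≈ expTerm y k
  expTerm-cong x≈y k = *-congʳ (^-cong x≈y k)

  ∣∣≤-^ : ∀ {x r} → ∣ x ∣≤ r → ∀ k → ∣ x ^ k ∣≤ r ^ k
  ∣∣≤-^ ∣x∣≤r zero    = 0≤⇒∣∣≤ 0≤1
  ∣∣≤-^ ∣x∣≤r (suc k) = ∣∣≤-* ∣x∣≤r (∣∣≤-^ ∣x∣≤r k)

  expTerm-dominated : ∀ {x r} → ∣ x ∣≤ r → Dominates (expTerm r) (expTerm x)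
  expTerm-dominated ∣x∣≤r k = ∣∣≤-* (∣∣≤-^ ∣x∣≤r k) (0≤⇒∣∣≤ (<⇒≤ (0<1/k! k)))

  expTerm-nonneg : ∀ {x} → 0# ≤ x → Nonneg (expTerm x)
  expTerm-nonneg 0≤x k = ∣∣≤⇒0≤ (expTerm-dominated (0≤⇒∣∣≤ 0≤x) k)

  -- The binomial theorem.  Multiplied by k + 1 = i + j, the terms x^i/i! · y^j/j!
  -- with i + j = k + 1 split into i-weighted and j-weighted sums, and each of
  -- these is a multiple of the sum for k.
  expTerm-+ : ∀ x y k → diagonal k (λ i j → expTerm x i * expTerm y j) ≈ expTerm (x + y) k
  expTerm-+ x y zero = begin-equality
    expTerm x 0 * expTerm y 0  ≈⟨ *-cong (expTerm-zero x) (expTerm-zero y) ⟩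
    1# * 1#                    ≈⟨ *-identityˡ 1# ⟩
    1#                         ≈⟨ expTerm-zero (x + y) ⟨
    expTerm (x + y) 0          ∎
  expTerm-+ x y (suc k) = *-cancelˡ-≈ (0<fromℕ-suc k) (begin-equality
    fromℕ (suc k) * diagonal (suc k) a
      ≈⟨ diagonal-weighted fromℕ a (suc k) ⟨
    diagonal (suc k) (λ i j → fromℕ (i ℕ.+ j) * a i j)
      ≈⟨ diagonal-cong (λ i j → trans (*-congʳ (fromℕ-+ i j)) (distribʳ (a i j) _ _)) (suc k) ⟩
    diagonal (suc k) (λ i j → fromℕ i * a i j + fromℕ j * a i j)
      ≈⟨ diagonal-+ (λ i j → fromℕ i * a i j) (λ i j → fromℕ j * a i j) (suc k) ⟩
    diagonal (suc k) (λ i j → fromℕ i * a i j) + diagonal (suc k) (λ i j → fromℕ j * a i j)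
      ≈⟨ +-cong i-weighted j-weighted ⟩
    x * diagonal k a + y * diagonal k a
      ≈⟨ distribʳ _ _ _ ⟨
    (x + y) * diagonal k a
      ≈⟨ *-congˡ (expTerm-+ x y k) ⟩
    (x + y) * expTerm (x + y) k
      ≈⟨ expTerm-suc (x + y) k ⟨
    fromℕ (suc k) * expTerm (x + y) (suc k)
      ∎)
    where
    a : ℕ → ℕ → Carrier
    a i j = expTerm x i * expTerm y j
    i-weighted : diagonal (suc k) (λ i j → fromℕ i * a i j) ≈ x * diagonal k a
    i-weighted = begin-equality
      0# * a 0 (suc k) + diagonal k (λ i j → fromℕ (suc i) * a (suc i) j)
        ≈⟨ +-cong (zeroˡ _) (diagonal-cong
             (λ i j → trans (sym (*-assoc _ _ _))
               (trans (*-congʳ (expTerm-suc x i)) (*-assoc _ _ _))) k) ⟩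
      0# + diagonal k (λ i j → x * a i j)
        ≈⟨ +-identityˡ _ ⟩
      diagonal k (λ i j → x * a i j)
        ≈⟨ diagonal-weighted (λ _ → x) a k ⟩
      x * diagonal k a
        ∎
    j-weighted : diagonal (suc k) (λ i j → fromℕ j * a i j) ≈ y * diagonal k a
    j-weighted = begin-equality
      diagonal (suc k) (λ i j → fromℕ j * a i j)
        ≈⟨ diagonal-back (λ i j → fromℕ j * a i j) k ⟩
      diagonal k (λ i j → fromℕ (suc j) * a i (suc j)) + 0# * a (suc k) 0
        ≈⟨ +-cong (diagonal-cong
             (λ i j → trans (swap _ _ _) (trans (*-congˡ (expTerm-suc y j)) (swap _ _ _))) k)
             (zeroˡ _) ⟩
      diagonal k (λ i j → y * a i j) + 0#
        ≈⟨ +-identityʳ _ ⟩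
      diagonal k (λ i j → y * a i j)
        ≈⟨ diagonal-weighted (λ _ → y) a k ⟩
      y * diagonal k a
        ∎
      where
      swap : ∀ u v w → u * (v * w) ≈ v * (u * w)
      swap = solve 3 (λ u v w → u :* (v :* w) := v :* (u :* w)) refl

  -- Tail of the exponential series.

  fromℕ-mono : ∀ {m n} → m ℕ.≤ n → fromℕ m ≤ fromℕ n
  fromℕ-mono {m} {n} m≤n = begin
    fromℕ m                    ≈⟨ +-identityˡ _ ⟨
    0# + fromℕ m               ≤⟨ +-mono-≤ (0≤fromℕ (n ℕ.∸ m)) ≤-refl ⟩
    fromℕ (n ℕ.∸ m) + fromℕ m  ≈⟨ fromℕ-+ (n ℕ.∸ m) m ⟨
    fromℕ (n ℕ.∸ m ℕ.+ m)      ≡⟨ ≡.cong fromℕ (ℕ.m∸n+n≡m m≤n) ⟩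
    fromℕ n                    ∎

  -- The ratio of consecutive terms is `r / (k + 1)`, so from index `p` on each term is at most half
  -- of the one before.
  module ExponentialTail {r : Carrier} (0≤r : 0# ≤ r) (p : ℕ) (2r≤p : r + r ≤ fromℕ (suc p)) where
    e = expTerm r

    halves : ∀ d → e (suc (d ℕ.+ p)) + e (suc (d ℕ.+ p)) ≤ e (d ℕ.+ p)
    halves d = *-cancelˡ-≤ (0<fromℕ-suc k) (begin
      fromℕ (suc k) * (e (suc k) + e (suc k))
        ≈⟨ distribˡ _ _ _ ⟩
      fromℕ (suc k) * e (suc k) + fromℕ (suc k) * e (suc k)
        ≈⟨ +-cong (expTerm-suc r k) (expTerm-suc r k) ⟩
      r * e k + r * e k
        ≈⟨ solve 2 (λ r u → r :* u :+ r :* u := u :* (r :+ r)) refl r (e k) ⟩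
      e k * (r + r)
        ≤⟨ *-monoʳ-≤ (expTerm-nonneg 0≤r k)
             (≤-trans 2r≤p (fromℕ-mono (ℕ.s≤s (ℕ.m≤n+m p d)))) ⟩
      e k * fromℕ (suc k)
        ≈⟨ *-comm _ _ ⟩
      fromℕ (suc k) * e k
        ∎)
      where k = d ℕ.+ p

    -- The partial sum plus twice the next term never increases: a step adds `e k` to the sum, while
    -- the doubled term falls from `e k + e k` to at most `e k`.
    tail : ∀ d → partialSums e (d ℕ.+ p) + (e (d ℕ.+ p) + e (d ℕ.+ p)) ≤ partialSums e p + (e p + e p)
    tail zero    = ≤-refl
    tail (suc d) = ≤-trans (begin
      partialSums e k + e k + (e (suc k) + e (suc k))  ≤⟨ +-mono-≤ ≤-refl (halves d) ⟩
      partialSums e k + e k + e k                      ≈⟨ +-assoc _ _ _ ⟩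
      partialSums e k + (e k + e k)                    ∎)
      (tail d)
      where k = d ℕ.+ p

    tail-bound : ∀ {n} → p ℕ.≤ n → partialSums e n - partialSums e p ≤ e p + e p
    tail-bound {n} p≤n = ≤-by
      (+-nonneg (0≤y-x (≡.subst (λ k → partialSums e k + (e k + e k) ≤ partialSums e p + (e p + e p))
                          (ℕ.m∸n+n≡m p≤n) (tail (n ℕ.∸ p))))
                (+-nonneg (expTerm-nonneg 0≤r n) (expTerm-nonneg 0≤r n)))
      (solve 4 (λ P S u v → u :+ u :- (S :- P) := P :+ (u :+ u) :- (S :+ (v :+ v)) :+ (v :+ v))
        refl (partialSums e p) (partialSums e n) (e p) (e n))

    -- A linear rate, extracted from the halving by `d + 2 ≤ 2 (d + 1)`, is the form that the
    -- Archimedean axiom can turn into smallness.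
    decay : ∀ d → fromℕ (suc d) * e (d ℕ.+ p) ≤ e p
    decay zero    = ≤-reflexive (trans (*-congʳ (+-identityʳ 1#)) (*-identityˡ _))
    decay (suc d) = begin
      fromℕ (suc (suc d)) * e (suc k)
        ≤⟨ ≤-by (*-nonneg (0≤fromℕ d) (expTerm-nonneg 0≤r (suc k)))
             (solve 2 (λ m u → (con (+ 1) :+ m) :* (u :+ u) :- (con (+ 1) :+ (con (+ 1) :+ m)) :* u
                                 := m :* u)
               refl (fromℕ d) (e (suc k))) ⟩
      fromℕ (suc d) * (e (suc k) + e (suc k))
        ≤⟨ *-monoʳ-≤ (0≤fromℕ (suc d)) (halves d) ⟩
      fromℕ (suc d) * e k
        ≤⟨ decay d ⟩
      e p
        ∎
      where k = d ℕ.+ p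

  expSeries-cauchy : ∀ {r} → 0# ≤ r → IsCauchy (partialSums (expTerm r))
  expSeries-cauchy {r} 0≤r ε 0<ε = q , λ m n q≤m q≤n →
    between (partialSums-mono (expTerm-nonneg 0≤r) q≤m) (T.tail-bound q≤m)
            (partialSums-mono (expTerm-nonneg 0≤r) q≤n) (T.tail-bound q≤n)
    where
    p = proj₁ (archimedean (r + r))
    2r≤p : ∀ {n} → p ℕ.≤ n → r + r ≤ fromℕ (suc n)
    2r≤p p≤n = ≤-trans (<⇒≤ (proj₂ (archimedean (r + r)))) (fromℕ-mono (ℕ.m≤n⇒m≤1+n p≤n))
    module D = ExponentialTail 0≤r p (2r≤p ℕ.≤-refl)
    e = expTerm r
    ε#0 = Equivalence.from #⇔<⊎> (inj₂ 0<ε)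
    -- With `d` above `2 e p / ε`, the decay from `p` to `q` brings the tail bound `e q + e q` at
    -- `q` below `ε`.
    Q = (e p + e p) / ε ⟨ ε#0 ⟩
    d = proj₁ (archimedean Q)
    q = d ℕ.+ p
    module T = ExponentialTail 0≤r q (2r≤p (ℕ.m≤n+m p d))
    2e<ε : e q + e q < ε
    2e<ε = *-cancelˡ-< (0<fromℕ-suc d) (begin-strict
      fromℕ (suc d) * (e q + e q)               ≈⟨ distribˡ _ _ _ ⟩
      fromℕ (suc d) * e q + fromℕ (suc d) * e q ≤⟨ +-mono-≤ (D.decay d) (D.decay d) ⟩
      e p + e p                                 ≈⟨ *-/-cancel ε#0 ⟨
      ε * Q                                     <⟨ *-monoʳ-< 0<ε (proj₂ (archimedean Q)) ⟩
      ε * fromℕ d                               ≤⟨ *-monoʳ-≤ (<⇒≤ 0<ε) (fromℕ-mono (ℕ.n≤1+n d)) ⟩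
      ε * fromℕ (suc d)                         ≈⟨ *-comm _ _ ⟩
      fromℕ (suc d) * ε                         ∎)
    between : ∀ {x y z} → z ≤ x → x - z ≤ e q + e q → z ≤ y → y - z ≤ e q + e q → ∣ x - y ∣< ε
    between {x} {y} {z} z≤x x-z≤ z≤y y-z≤ =
      (begin-strict
        - ε               <⟨ neg-mono-< (≤-<-trans y-z≤ 2e<ε) ⟩
        - (y - z)         ≤⟨ ≤-by (0≤y-x z≤x) (solve 3 (λ x y z → x :- y :- (:- (y :- z)) := x :- z)
                                                 refl x y z) ⟩
        x - y             ∎) ,
      (begin-strict
        x - y             ≤⟨ ≤-by (0≤y-x z≤y) (solve 3 (λ x y z → x :- z :- (x :- y) := y :- z)
                                                 refl x y z) ⟩
        x - z             ≤⟨ x-z≤ ⟩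
        e q + e q         <⟨ 2e<ε ⟩
        ε                 ∎)

  -- Power series majorised by the exponential series.

  powerSeries : (ℕ → Carrier) → Carrier → ℕ → Carrier
  powerSeries σ x = partialSums (λ k → σ k * expTerm x k)

  -- `σ k` is the coefficient of `x ^ k` multiplied by `k !`, so the bound `1#` is exactly what
  -- makes `expTerm r` a majorant for `∣ x ∣≤ r`.
  Bounded : (ℕ → Carrier) → Set ℓ₃
  Bounded σ = ∀ k → ∣ σ k ∣≤ 1#

  powerSeries-dominated : ∀ {σ x r} → Bounded σ → ∣ x ∣≤ r →
    Dominates (expTerm r) (λ k → σ k * expTerm x k)
  powerSeries-dominated ∣σ∣≤1 ∣x∣≤r k =
    ∣∣≤-resp refl (*-identityˡ _) (∣∣≤-* (∣σ∣≤1 k) (expTerm-dominated ∣x∣≤r k))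

  powerSeries-cauchy : ∀ {σ} → Bounded σ → ∀ x → IsCauchy (powerSeries σ x)
  powerSeries-cauchy ∣σ∣≤1 x = IsCauchy-dominated (powerSeries-dominated ∣σ∣≤1 ∣x∣≤b)
    (expSeries-cauchy (∣∣≤⇒0≤ ∣x∣≤b))
    where ∣x∣≤b = proj₂ (proj₂ (bounded x))

  -- Covers cosine and sine at once: the second hypothesis has the shape of the real or imaginary
  -- part of `i^(m+n) = i^m i^n`. The squares converge to the right-hand side, and the triangles are
  -- the partial sums at `x + y` by the binomial theorem.
  powerSeries-+ : ∀ {σ p q r t x y P Q R T} → Bounded σ →
    (∀ i j → σ (i ℕ.+ j) ≈ p i * q j + r i * t j) →
    powerSeries p x ⟶ P → powerSeries q y ⟶ Q → powerSeries r x ⟶ R → powerSeries t y ⟶ T →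
    powerSeries σ (x + y) ⟶ P * Q + R * T
  powerSeries-+ {σ} {p} {q} {r} {t} {x} {y} {P} {Q} {R} {T} ∣σ∣≤1 split p⟶P q⟶Q r⟶R t⟶T =
    ⟶-resp-≈ triangle≈ (solve 1 (λ u → u :- con (+ 0) := u) refl (P * Q + R * T))
      (⟶-+ (⟶-resp-≈ rectangle≈ refl (⟶-+ (⟶-* p⟶P q⟶Q) (⟶-* r⟶R t⟶T)))
           (⟶-neg (square-triangle⟶0 dominated cauchy)))
    where
    X = proj₁ (bounded x)
    ∣x∣≤X = proj₂ (proj₂ (bounded x))
    Y = proj₁ (bounded y)
    ∣y∣≤Y = proj₂ (proj₂ (bounded y))
    a b : ℕ → ℕ → Carrier
    a i j = σ (i ℕ.+ j) * (expTerm x i * expTerm y j)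
    b i j = expTerm X i * expTerm Y j
    dominated : ∀ i → Dominates (b i) (a i)
    dominated i j = ∣∣≤-resp refl (*-identityˡ _)
      (∣∣≤-* (∣σ∣≤1 (i ℕ.+ j)) (∣∣≤-* (expTerm-dominated ∣x∣≤X i) (expTerm-dominated ∣y∣≤Y j)))
    -- By the binomial theorem the triangles of the majorant are the partial sums of the exponential
    -- series at `X + Y`.
    cauchy : IsCauchy (λ n → triangle n b)
    cauchy = IsCauchy-resp-≈ (λ n → sym (partialSums-cong (expTerm-+ X Y) n))
      (expSeries-cauchy (+-nonneg (∣∣≤⇒0≤ ∣x∣≤X) (∣∣≤⇒0≤ ∣y∣≤Y)))
    rectangle≈ : ∀ n → powerSeries p x n * powerSeries q y n + powerSeries r x n * powerSeries t y n
                       ≈ rectangle n n a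
    rectangle≈ n = begin-equality
      powerSeries p x n * powerSeries q y n + powerSeries r x n * powerSeries t y n
        ≈⟨ +-cong (rectangle-product _ _ n n) (rectangle-product _ _ n n) ⟨
      rectangle n n (λ i j → p i * expTerm x i * (q j * expTerm y j))
        + rectangle n n (λ i j → r i * expTerm x i * (t j * expTerm y j))
        ≈⟨ rectangle-+ _ _ n n ⟨
      rectangle n n (λ i j → p i * expTerm x i * (q j * expTerm y j)
                               + r i * expTerm x i * (t j * expTerm y j))
        ≈⟨ rectangle-cong (λ i j → trans
             (solve 6 (λ p q r t u v → p :* u :* (q :* v) :+ r :* u :* (t :* v)
                                         := (p :* q :+ r :* t) :* (u :* v))
               refl (p i) (q j) (r i) (t j) (expTerm x i) (expTerm y j))
             (*-congʳ (sym (split i j)))) n n ⟩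
      rectangle n n a
        ∎
    triangle≈ : ∀ n → rectangle n n a - (rectangle n n a - triangle n a) ≈ powerSeries σ (x + y) n
    triangle≈ n = begin-equality
      rectangle n n a - (rectangle n n a - triangle n a)
        ≈⟨ solve 2 (λ u v → u :- (u :- v) := v) refl (rectangle n n a) (triangle n a) ⟩
      triangle n a
        ≈⟨ partialSums-cong (λ k → trans (diagonal-weighted σ _ k) (*-congˡ (expTerm-+ x y k))) n ⟩
      powerSeries σ (x + y) n
        ∎

  -- For `η ≤ 1#` the halving starts at index 1, so everything after the constant term is bounded by
  -- twice the linear term `η`.
  powerSeries-small : ∀ {σ η h l} → Bounded σ → η ≤ 1# → ∣ h ∣≤ η → powerSeries σ h ⟶ l →
    ∣ l - σ 0 ∣≤ (η + η)
  powerSeries-small {σ} {η} {h} {l} ∣σ∣≤1 η≤1 ∣h∣≤η σ⟶l = ⟶-∣∣≤ bound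
    -- Passing to `suc` skips the empty partial sum, which does not yet contain the constant term.
    (⟶-+ (⟶-subsequence suc ℕ.n≤1+n σ⟶l) (⟶-const (- σ 0)))
    where
    open ExponentialTail (∣∣≤⇒0≤ ∣h∣≤η) 1
      (≤-trans (+-mono-≤ η≤1 η≤1) (≤-reflexive (+-congˡ (sym (+-identityʳ 1#)))))
    first : powerSeries σ h 1 ≈ σ 0
    first = trans (+-identityˡ _) (trans (*-congˡ (expTerm-zero h)) (*-identityʳ _))
    bound : ∀ n → ∣ powerSeries σ h (suc n) - σ 0 ∣≤ (η + η)
    bound n = ∣∣≤-weaken
      (≤-trans (tail-bound {suc n} (ℕ.s≤s ℕ.z≤n))
        (≤-reflexive (+-cong (expTerm-one η) (expTerm-one η))))
      (∣∣≤-resp (+-congˡ (-‿cong first)) refl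
        (partialSums-dominated (powerSeries-dominated {σ} ∣σ∣≤1 ∣h∣≤η) {1} {suc n} (ℕ.s≤s ℕ.z≤n)))

-- Cosine and sine as power series.

module Trigonometry {c ℓ₁ ℓ₂ ℓ₃} (ℝ : RealNumbers c ℓ₁ ℓ₂ ℓ₃) where
  open RealNumbers ℝ
  open Analysis ℝ
  open OrderedFieldProperties orderedField
  open IntegerRingSolver commutativeRing
  open Limits ℝ
  open Series ℝ
  open ≤-Reasoning

  -- The real and imaginary parts of i^k.
  cosCoeff sinCoeff : ℕ → Carrier
  cosCoeff zero    = 1#
  cosCoeff (suc k) = - sinCoeff k
  sinCoeff zero    = 0#
  sinCoeff (suc k) = cosCoeff k

  cosCoeff-bounded : Bounded cosCoeff
  sinCoeff-bounded : Bounded sinCoeff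
  cosCoeff-bounded zero    = 0≤⇒∣∣≤ 0≤1
  cosCoeff-bounded (suc k) = ∣∣≤-neg (sinCoeff-bounded k)
  sinCoeff-bounded zero    = ∣0∣≤ 0≤1
  sinCoeff-bounded (suc k) = cosCoeff-bounded k

  -- The two components of `i^(m+n) = i^m i^n`, by simultaneous induction. The sign sits on the
  -- first factor so that the series of `- sin` can take the role of `r` in `powerSeries-+`.
  cosCoeff-+ : ∀ i j → cosCoeff (i ℕ.+ j) ≈ cosCoeff i * cosCoeff j + - sinCoeff i * sinCoeff j
  sinCoeff-+ : ∀ i j → sinCoeff (i ℕ.+ j) ≈ sinCoeff i * cosCoeff j + cosCoeff i * sinCoeff j
  cosCoeff-+ zero    j = solve 2 (λ c s → c := con (+ 1) :* c :+ (:- con (+ 0)) :* s) refl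
                           (cosCoeff j) (sinCoeff j)
  cosCoeff-+ (suc i) j = trans (-‿cong (sinCoeff-+ i j))
    (solve 4 (λ c s c′ s′ → :- (s :* c′ :+ c :* s′) := (:- s) :* c′ :+ (:- c) :* s′) refl
      (cosCoeff i) (sinCoeff i) (cosCoeff j) (sinCoeff j))
  sinCoeff-+ zero    j = solve 2 (λ c s → s := con (+ 0) :* c :+ con (+ 1) :* s) refl
                           (cosCoeff j) (sinCoeff j)
  sinCoeff-+ (suc i) j = cosCoeff-+ i j

  -- The coefficient vanishes at the other parity, so keeping it as a factor lets a mutual induction
  -- replace the split into even and odd `k`.
  cosCoeff-parity : ∀ x k → cosCoeff k * (- x) ^ k ≈ cosCoeff k * x ^ k
  sinCoeff-parity : ∀ x k → sinCoeff k * (- x) ^ k ≈ - (sinCoeff k * x ^ k)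
  cosCoeff-parity x zero    = refl
  cosCoeff-parity x (suc k) = begin-equality
    - s * (- x * (- x) ^ k)
      ≈⟨ solve 3 (λ s x p → (:- s) :* ((:- x) :* p) := x :* (s :* p)) refl s x _ ⟩
    x * (s * (- x) ^ k)      ≈⟨ *-congˡ (sinCoeff-parity x k) ⟩
    x * - (s * x ^ k)
      ≈⟨ solve 3 (λ s x p → x :* (:- (s :* p)) := (:- s) :* (x :* p)) refl s x _ ⟩
    - s * (x * x ^ k)        ∎
    where s = sinCoeff k
  sinCoeff-parity x zero    = solve 0 (con (+ 0) :* con (+ 1) := :- (con (+ 0) :* con (+ 1))) refl
  sinCoeff-parity x (suc k) = begin-equality
    c′ * (- x * (- x) ^ k)
      ≈⟨ solve 3 (λ c x p → c :* ((:- x) :* p) := :- (x :* (c :* p))) refl c′ x _ ⟩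
    - (x * (c′ * (- x) ^ k)) ≈⟨ -‿cong (*-congˡ (cosCoeff-parity x k)) ⟩
    - (x * (c′ * x ^ k))
      ≈⟨ solve 3 (λ c x p → :- (x :* (c :* p)) := :- (c :* (x :* p))) refl c′ x _ ⟩
    - (c′ * (x * x ^ k))     ∎
    where c′ = cosCoeff k

  cosCoeff-even : ∀ k → cosCoeff (2 ℕ.* k) ≈ (- 1#) ^ k
  cosCoeff-even zero    = refl
  cosCoeff-even (suc k) = begin-equality
    cosCoeff (2 ℕ.* suc k)  ≡⟨ ≡.cong cosCoeff (ℕ.*-suc 2 k) ⟩
    - cosCoeff (2 ℕ.* k)    ≈⟨ -‿cong (cosCoeff-even k) ⟩
    - (- 1#) ^ k            ≈⟨ solve 1 (λ p → :- p := (:- con (+ 1)) :* p) refl _ ⟩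
    - 1# * (- 1#) ^ k       ∎

  sinCoeff-even : ∀ k → sinCoeff (2 ℕ.* k) ≈ 0#
  sinCoeff-even zero    = refl
  sinCoeff-even (suc k) = begin-equality
    sinCoeff (2 ℕ.* suc k)  ≡⟨ ≡.cong sinCoeff (ℕ.*-suc 2 k) ⟩
    - sinCoeff (2 ℕ.* k)    ≈⟨ -‿cong (sinCoeff-even k) ⟩
    - 0#                    ≈⟨ solve 0 (:- con (+ 0) := con (+ 0)) refl ⟩
    0#                      ∎

  -- The odd terms vanish, so twice as many terms of the full series give the series behind `Cos`;
  -- the quotient in `cosTerm` is literally an `expTerm`.
  partialSums-cosTerm : ∀ x n → powerSeries cosCoeff x (2 ℕ.* n) ≈ partialSums (cosTerm x) n
  partialSums-cosTerm x zero    = refl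
  partialSums-cosTerm x (suc n) = begin-equality
    powerSeries cosCoeff x (2 ℕ.* suc n)
      ≡⟨ ≡.cong (powerSeries cosCoeff x) (ℕ.*-suc 2 n) ⟩
    powerSeries cosCoeff x (2 ℕ.* n) + cosCoeff (2 ℕ.* n) * u + - sinCoeff (2 ℕ.* n) * v
      ≈⟨ +-cong (+-cong (partialSums-cosTerm x n) (*-congʳ (cosCoeff-even n)))
                (*-congʳ (-‿cong (sinCoeff-even n))) ⟩
    partialSums (cosTerm x) n + (- 1#) ^ n * u + - 0# * v
      ≈⟨ solve 2 (λ t v → t :+ (:- con (+ 0)) :* v := t) refl _ v ⟩
    partialSums (cosTerm x) (suc n)
      ∎
    where
    u = expTerm x (2 ℕ.* n)
    v = expTerm x (suc (2 ℕ.* n))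

  partialSums-sinTerm : ∀ x n → powerSeries sinCoeff x (2 ℕ.* n) ≈ partialSums (sinTerm x) n
  partialSums-sinTerm x zero    = refl
  partialSums-sinTerm x (suc n) = begin-equality
    powerSeries sinCoeff x (2 ℕ.* suc n)
      ≡⟨ ≡.cong (powerSeries sinCoeff x) (ℕ.*-suc 2 n) ⟩
    powerSeries sinCoeff x (2 ℕ.* n) + sinCoeff (2 ℕ.* n) * u + cosCoeff (2 ℕ.* n) * v
      ≈⟨ +-cong (+-cong (partialSums-sinTerm x n) (*-congʳ (sinCoeff-even n)))
                (*-cong (cosCoeff-even n) (reflexive (≡.cong (expTerm x) (ℕ.+-comm 1 (2 ℕ.* n))))) ⟩
    partialSums (sinTerm x) n + 0# * u + (- 1#) ^ n * expTerm x (2 ℕ.* n ℕ.+ 1)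
      ≈⟨ +-congʳ (solve 2 (λ t u → t :+ con (+ 0) :* u := t) refl _ u) ⟩
    partialSums (sinTerm x) (suc n)
      ∎
    where
    u = expTerm x (2 ℕ.* n)
    v = expTerm x (suc (2 ℕ.* n))

  abstract
    -- Kept opaque: outside this block both functions are known only as limits of their series.
    cos sin : Carrier → Carrier
    cos x = proj₁ (complete (powerSeries cosCoeff x) (powerSeries-cauchy {cosCoeff} cosCoeff-bounded x))
    sin x = proj₁ (complete (powerSeries sinCoeff x) (powerSeries-cauchy {sinCoeff} sinCoeff-bounded x))

    cosSeries⟶cos : ∀ x → powerSeries cosCoeff x ⟶ cos x
    cosSeries⟶cos x =
      proj₂ (complete (powerSeries cosCoeff x) (powerSeries-cauchy {cosCoeff} cosCoeff-bounded x))

    sinSeries⟶sin : ∀ x → powerSeries sinCoeff x ⟶ sin x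
    sinSeries⟶sin x =
      proj₂ (complete (powerSeries sinCoeff x) (powerSeries-cauchy {sinCoeff} sinCoeff-bounded x))

  Cos-cos : ∀ x → Cos x (cos x)
  Cos-cos x =
    ⟶-resp-≈ {λ n → powerSeries cosCoeff x (2 ℕ.* n)} {partialSums (cosTerm x)}
      (partialSums-cosTerm x) refl
      (⟶-subsequence {powerSeries cosCoeff x} (2 ℕ.*_) (λ n → ℕ.m≤m+n n (n ℕ.+ 0)) (cosSeries⟶cos x))

  Sin-sin : ∀ x → Sin x (sin x)
  Sin-sin x =
    ⟶-resp-≈ {λ n → powerSeries sinCoeff x (2 ℕ.* n)} {partialSums (sinTerm x)}
      (partialSums-sinTerm x) refl
      (⟶-subsequence {powerSeries sinCoeff x} (2 ℕ.*_) (λ n → ℕ.m≤m+n n (n ℕ.+ 0)) (sinSeries⟶sin x))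

  powerSeries-cong : ∀ σ {x y} → x ≈ y → ∀ n → powerSeries σ x n ≈ powerSeries σ y n
  powerSeries-cong σ x≈y = partialSums-cong (λ k → *-congˡ (expTerm-cong x≈y k))

  -- `complete` is not assumed to respect `≈`; congruence follows from uniqueness of limits.
  cos-cong : ∀ {x y} → x ≈ y → cos x ≈ cos y
  cos-cong {x} {y} x≈y =
    ⟶-unique (⟶-resp-≈ (powerSeries-cong cosCoeff x≈y) refl (cosSeries⟶cos x)) (cosSeries⟶cos y)

  sin-cong : ∀ {x y} → x ≈ y → sin x ≈ sin y
  sin-cong {x} {y} x≈y =
    ⟶-unique (⟶-resp-≈ (powerSeries-cong sinCoeff x≈y) refl (sinSeries⟶sin x)) (sinSeries⟶sin y)

  -sinSeries⟶-sin : ∀ x → powerSeries (λ k → - sinCoeff k) x ⟶ - sin x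
  -sinSeries⟶-sin x = ⟶-resp-≈
    (λ n → trans (sym (partialSums-neg _ n)) (partialSums-cong
      (λ k → solve 2 (λ s e → :- (s :* e) := (:- s) :* e) refl (sinCoeff k) (expTerm x k)) n))
    refl (⟶-neg (sinSeries⟶sin x))

  cos-+ : ∀ x y → cos (x + y) ≈ cos x * cos y - sin x * sin y
  cos-+ x y = trans
    (⟶-unique (cosSeries⟶cos (x + y))
      (powerSeries-+ {cosCoeff} cosCoeff-bounded cosCoeff-+
        (cosSeries⟶cos x) (cosSeries⟶cos y) (-sinSeries⟶-sin x) (sinSeries⟶sin y)))
    (solve 4 (λ c s c′ s′ → c :* c′ :+ (:- s) :* s′ := c :* c′ :- s :* s′) refl
      (cos x) (sin x) (cos y) (sin y))

  sin-+ : ∀ x y → sin (x + y) ≈ sin x * cos y + cos x * sin y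
  sin-+ x y = ⟶-unique (sinSeries⟶sin (x + y))
    (powerSeries-+ {sinCoeff} sinCoeff-bounded sinCoeff-+
      (sinSeries⟶sin x) (cosSeries⟶cos y) (cosSeries⟶cos x) (sinSeries⟶sin y))

  cos-neg : ∀ x → cos (- x) ≈ cos x
  cos-neg x = ⟶-unique (cosSeries⟶cos (- x)) (⟶-resp-≈
    (partialSums-cong (λ k → trans (sym (*-assoc _ _ _))
      (trans (*-congʳ (sym (cosCoeff-parity x k))) (*-assoc _ _ _))))
    refl (cosSeries⟶cos x))

  sin-neg : ∀ x → sin (- x) ≈ - sin x
  sin-neg x = ⟶-unique (sinSeries⟶sin (- x)) (⟶-resp-≈
    (λ n → trans (sym (partialSums-neg _ n)) (partialSums-cong
      (λ k → trans (solve 3 (λ s p u → :- (s :* (p :* u)) := (:- (s :* p)) :* u) refl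
                     (sinCoeff k) (x ^ k) (1/k! k))
        (trans (*-congʳ (sym (sinCoeff-parity x k))) (*-assoc _ _ _))) n))
    refl (⟶-neg (sinSeries⟶sin x)))

  cos-small : ∀ {η h} → η ≤ 1# → ∣ h ∣≤ η → ∣ cos h - 1# ∣≤ (η + η)
  cos-small {h = h} η≤1 ∣h∣≤η =
    powerSeries-small {cosCoeff} cosCoeff-bounded η≤1 ∣h∣≤η (cosSeries⟶cos h)

  sin-small : ∀ {η h} → η ≤ 1# → ∣ h ∣≤ η → ∣ sin h ∣≤ (η + η)
  sin-small {h = h} η≤1 ∣h∣≤η =
    ∣∣≤-resp (solve 1 (λ s → s :- con (+ 0) := s) refl (sin h)) refl
      (powerSeries-small {sinCoeff} sinCoeff-bounded η≤1 ∣h∣≤η (sinSeries⟶sin h))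

  ∣∣≤0⇒≈0 : ∀ {x} → ∣ x ∣≤ (0# + 0#) → x ≈ 0#
  ∣∣≤0⇒≈0 (l , u) = ≤-antisym
    (≤-trans u (≤-reflexive (+-identityˡ 0#)))
    (≤-trans (≤-reflexive (solve 0 (con (+ 0) := :- (con (+ 0) :+ con (+ 0))) refl)) l)

  sin-0 : sin 0# ≈ 0#
  sin-0 = ∣∣≤0⇒≈0 (sin-small 0≤1 (∣0∣≤ ≤-refl))

  cos-0 : cos 0# ≈ 1#
  cos-0 = trans (solve 1 (λ c → c := c :- con (+ 1) :+ con (+ 1)) refl (cos 0#))
    (trans (+-congʳ (∣∣≤0⇒≈0 (cos-small 0≤1 (∣0∣≤ ≤-refl)))) (+-identityˡ 1#))

  cos²+sin²≈1 : ∀ x → cos x * cos x + sin x * sin x ≈ 1#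
  cos²+sin²≈1 x = begin-equality
    cos x * cos x + sin x * sin x
      ≈⟨ solve 2 (λ c s → c :* c :+ s :* s := c :* c :- s :* (:- s)) refl (cos x) (sin x) ⟩
    cos x * cos x - sin x * - sin x
      ≈⟨ +-cong (*-congˡ (cos-neg x)) (-‿cong (*-congˡ (sin-neg x))) ⟨
    cos x * cos (- x) - sin x * sin (- x)  ≈⟨ cos-+ x (- x) ⟨
    cos (x - x)                            ≈⟨ cos-cong (-‿inverseʳ x) ⟩
    cos 0#                                 ≈⟨ cos-0 ⟩
    1#                                     ∎

  -- Continuity from the addition formulas.

  combination-small : ∀ u v ε → 0# < ε →
    ∃[ δ ] 0# < δ × (∀ h → ∣ h ∣< δ → ∣ u * (cos h - 1#) + v * sin h ∣< ε)
  combination-small u v ε 0<ε = η , proj₁ (proj₂ scaled) , λ h ∣h∣<η →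
    let ∣h∣≤η = ∣∣<⇒∣∣≤ ∣h∣<η in
    ∣∣≤-<-trans
      (∣∣≤-resp refl
        (solve 3 (λ U V η → U :* (η :+ η) :+ V :* (η :+ η) := (U :+ V :+ (U :+ V)) :* η) refl U V η)
        (∣∣≤-+ (∣∣≤-* (proj₂ (proj₂ (bounded u))) (cos-small η≤1 ∣h∣≤η))
               (∣∣≤-* (proj₂ (proj₂ (bounded v))) (sin-small η≤1 ∣h∣≤η))))
      (proj₂ (proj₂ (proj₂ scaled)))
    where
    U = proj₁ (bounded u)
    V = proj₁ (bounded v)
    0<U+V : 0# < U + V
    0<U+V = +-pos (proj₁ (proj₂ (bounded u))) (proj₁ (proj₂ (bounded v)))
    scaled = rescale 0<ε (+-pos 0<U+V 0<U+V)
    η = proj₁ scaled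
    η≤1 = proj₁ (proj₂ (proj₂ scaled))

  -- When the increment is a combination of `cos h - 1#` and `sin h` with coefficients free of `h`,
  -- continuity at every point reduces to smallness near `h = 0`.
  continuous : ∀ {f} (u v : Carrier → Carrier) → (∀ {x y} → x ≈ y → f x ≈ f y) →
    (∀ x h → f (x + h) - f x ≈ u x * (cos h - 1#) + v x * sin h) → Continuous f
  continuous {f} u v f-cong expansion x ε 0<ε = proj₁ small , proj₁ (proj₂ small) , λ y ∣y-x∣<δ →
    ∣∣<-resp
      (trans (sym (expansion x (y - x)))
        (+-congʳ (f-cong (solve 2 (λ x y → x :+ (y :- x) := y) refl x y))))
      refl (proj₂ (proj₂ small) (y - x) ∣y-x∣<δ)
    where small = combination-small (u x) (v x) ε 0<ε

  cos-continuous : Continuous cos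
  cos-continuous = continuous cos (λ x → - sin x) cos-cong λ x h →
    trans (+-congʳ (cos-+ x h))
      (solve 4 (λ c s c′ s′ → c :* c′ :- s :* s′ :- c := c :* (c′ :- con (+ 1)) :+ (:- s) :* s′) refl
        (cos x) (sin x) (cos h) (sin h))

  continuous-scale : ∀ {f} → Continuous f → (∀ {x y} → x ≈ y → f x ≈ f y) →
    ∀ ω → Continuous (λ t → f (ω * t))
  continuous-scale {f} f-continuous f-cong ω t ε 0<ε = η , proj₁ (proj₂ scaled) , λ y ∣y-t∣<η →
    proj₂ (proj₂ close) (ω * y)
      (∣∣<-resp (solve 3 (λ ω y t → ω :* (y :- t) := ω :* y :- ω :* t) refl ω y t) refl
        (∣∣≤-<-trans (∣∣≤-* (proj₂ (proj₂ (bounded ω))) (∣∣<⇒∣∣≤ ∣y-t∣<η))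
          (proj₂ (proj₂ (proj₂ scaled)))))
    where
    close = f-continuous (ω * t) ε 0<ε
    scaled = rescale (proj₁ (proj₂ close)) (proj₁ (proj₂ (bounded ω)))
    η = proj₁ scaled

  -- Values at π and shifts by a half period.

  sin-π : ∀ {π} → IsPi π → sin π ≈ 0#
  sin-π {π} (_ , Sin-π , _) = ⟶-unique (Sin-sin π) Sin-π

  -- At h = π/2 a zero of sin is excluded by minimality, so cos π = 1 - 2 sin² h
  -- is not 1, and cos² π = 1 leaves only -1.
  cos-π : ∀ {π} → IsPi π → cos π ≈ - 1#
  cos-π {π} isPi@(0<π , _ , minimal) = proj₁ (tight (cos π) (- 1#)) λ cosπ#-1 →
    cosπ≉1 (cosπ≈1 (#⇒invertible cosπ#-1))
    where
    h = half π
    sin-h≉0 : ¬ (sin h ≈ 0#)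
    sin-h≉0 sin-h≈0 =
      minimal h (half-pos 0<π) (half<x 0<π) (⟶-resp-≈ (λ _ → refl) sin-h≈0 (Sin-sin h))
    double : sin h * sin h + sin h * sin h ≈ 1# - cos π
    double = begin-equality
      sin h * sin h + sin h * sin h
        ≈⟨ solve 2 (λ c s → s :* s :+ s :* s := (c :* c :+ s :* s) :- (c :* c :- s :* s)) refl
             (cos h) (sin h) ⟩
      (cos h * cos h + sin h * sin h) - (cos h * cos h - sin h * sin h)
        ≈⟨ +-cong (cos²+sin²≈1 h) (-‿cong (trans (sym (cos-+ h h)) (cos-cong (half+half π)))) ⟩
      1# - cos π
        ∎
    square-pos : ∀ {x} → x # 0# → 0# < x * x
    square-pos {x} x#0 =
      [ (λ x<0 → <-by (*-pos (0<y-x x<0) (0<y-x x<0))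
                   (solve 1 (λ x → x :* x :- con (+ 0) := (con (+ 0) :- x) :* (con (+ 0) :- x)) refl x))
      , (λ 0<x → *-pos 0<x 0<x)
      ]′ (Equivalence.to #⇔<⊎> x#0)
    cosπ≉1 : ¬ (cos π ≈ 1#)
    cosπ≉1 cosπ≈1 = sin-h≉0 (proj₁ (tight (sin h) 0#) λ sin-h#0 →
      <-irrefl (sym (trans double (trans (+-congˡ (-‿cong cosπ≈1)) (-‿inverseʳ 1#))))
        (+-pos (square-pos sin-h#0) (square-pos sin-h#0)))
    product : (cos π - 1#) * (cos π - - 1#) ≈ 0#
    product = begin-equality
      (cos π - 1#) * (cos π - - 1#)
        ≈⟨ solve 2 (λ c s → (c :- con (+ 1)) :* (c :- (:- con (+ 1)))
                              := c :* c :+ s :* s :- con (+ 1) :- s :* s) refl (cos π) (sin π) ⟩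
      cos π * cos π + sin π * sin π - 1# - sin π * sin π
        ≈⟨ +-cong (+-congʳ (cos²+sin²≈1 π)) (-‿cong (*-cong (sin-π isPi) (sin-π isPi))) ⟩
      1# - 1# - 0# * 0#
        ≈⟨ solve 0 (con (+ 1) :- con (+ 1) :- con (+ 0) :* con (+ 0) := con (+ 0)) refl ⟩
      0#
        ∎
    cosπ≈1 : ∃[ w ] (w * (cos π - - 1#) ≈ 1# × (cos π - - 1#) * w ≈ 1#) → cos π ≈ 1#
    cosπ≈1 (w , _ , eq) = begin-equality
      cos π
        ≈⟨ solve 1 (λ c → c := (c :- con (+ 1)) :* con (+ 1) :+ con (+ 1)) refl (cos π) ⟩
      (cos π - 1#) * 1# + 1#
        ≈⟨ +-congʳ (*-congˡ eq) ⟨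
      (cos π - 1#) * ((cos π - - 1#) * w) + 1#
        ≈⟨ +-congʳ (*-assoc _ _ _) ⟨
      (cos π - 1#) * (cos π - - 1#) * w + 1#
        ≈⟨ +-congʳ (*-congʳ product) ⟩
      0# * w + 1#
        ≈⟨ solve 1 (λ w → con (+ 0) :* w :+ con (+ 1) := con (+ 1)) refl w ⟩
      1#
        ∎

  cos-+π : ∀ {π} → IsPi π → ∀ x → cos (x + π) ≈ - cos x
  cos-+π {π} isPi x = begin-equality
    cos (x + π)                    ≈⟨ cos-+ x π ⟩
    cos x * cos π - sin x * sin π  ≈⟨ +-cong (*-congˡ (cos-π isPi)) (-‿cong (*-congˡ (sin-π isPi))) ⟩
    cos x * - 1# - sin x * 0#
      ≈⟨ solve 2 (λ c s → c :* (:- con (+ 1)) :- s :* con (+ 0) := :- c) refl (cos x) (sin x) ⟩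
    - cos x                        ∎

  sin-+π : ∀ {π} → IsPi π → ∀ x → sin (x + π) ≈ - sin x
  sin-+π {π} isPi x = begin-equality
    sin (x + π)                    ≈⟨ sin-+ x π ⟩
    sin x * cos π + cos x * sin π  ≈⟨ +-cong (*-congˡ (cos-π isPi)) (*-congˡ (sin-π isPi)) ⟩
    sin x * - 1# + cos x * 0#
      ≈⟨ solve 2 (λ c s → s :* (:- con (+ 1)) :+ c :* con (+ 0) := :- s) refl (cos x) (sin x) ⟩
    - sin x                        ∎

  -- Harmonic oscillations around a constant.

  harmonic : (α β γ θ : Carrier) → Carrier
  harmonic α β γ θ = α * cos θ + β * sin θ + γ

  module Harmonic (α β γ : Carrier) where
    f = harmonic α β γ

    harmonic-cong : ∀ {θ φ} → θ ≈ φ → f θ ≈ f φ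
    harmonic-cong θ≈φ = +-congʳ (+-cong (*-congˡ (cos-cong θ≈φ)) (*-congˡ (sin-cong θ≈φ)))

    harmonic-continuous : Continuous f
    harmonic-continuous = continuous
      (λ θ → α * cos θ + β * sin θ) (λ θ → β * cos θ - α * sin θ) harmonic-cong λ θ h →
      trans (+-congʳ (+-congʳ (+-cong (*-congˡ (cos-+ θ h)) (*-congˡ (sin-+ θ h)))))
        (solve 7 (λ α β γ c s c′ s′ →
            α :* (c :* c′ :- s :* s′) :+ β :* (s :* c′ :+ c :* s′) :+ γ :- (α :* c :+ β :* s :+ γ)
              := (α :* c :+ β :* s) :* (c′ :- con (+ 1)) :+ (β :* c :- α :* s) :* s′)
          refl α β γ (cos θ) (sin θ) (cos h) (sin h))

    -- The full period is taken as two shifts by `π`, each reversing the sign of cosine and sine.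
    harmonic-2π : ∀ {π} → IsPi π → ∀ θ → f (θ + (π + π)) ≈ f θ
    harmonic-2π {π} isPi θ = trans (harmonic-cong (sym (+-assoc θ π π)))
      (+-congʳ (+-cong (*-congˡ (flips cos (cos-+π isPi))) (*-congˡ (flips sin (sin-+π isPi)))))
      where
      flips : ∀ g → (∀ x → g (x + π) ≈ - g x) → g (θ + π + π) ≈ g θ
      flips g flip-sign = trans (flip-sign (θ + π)) (trans (-‿cong (flip-sign θ))
        (solve 1 (λ u → :- (:- u) := u) refl (g θ)))

    -- In the sum of the values at `θ + φ` and `θ - φ` the `sin φ` terms cancel, leaving `2 cos φ`
    -- times the oscillating part; the summand with factor `γ` corrects for the constant.
    harmonic-recurrence : ∀ θ φ →
      f (θ + φ) ≈ (fromℕ 2 - fromℕ 2 * cos φ) * γ + fromℕ 2 * cos φ * f θ - f (θ - φ)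
    harmonic-recurrence θ φ = begin-equality
      f (θ + φ)
        ≈⟨ +-congʳ (+-cong (*-congˡ (cos-+ θ φ)) (*-congˡ (sin-+ θ φ))) ⟩
      α * (C * C′ - S * S′) + β * (S * C′ + C * S′) + γ
        ≈⟨ solve 7 (λ α β γ C S C′ S′ →
               let two = con (+ 1) :+ (con (+ 1) :+ con (+ 0)) in
               α :* (C :* C′ :- S :* S′) :+ β :* (S :* C′ :+ C :* S′) :+ γ
                 := (two :- two :* C′) :* γ :+ two :* C′ :* (α :* C :+ β :* S :+ γ)
                      :- (α :* (C :* C′ :- S :* (:- S′)) :+ β :* (S :* C′ :+ C :* (:- S′)) :+ γ))
             refl α β γ C S C′ S′ ⟩
      (fromℕ 2 - fromℕ 2 * C′) * γ + fromℕ 2 * C′ * f θ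
        - (α * (C * C′ - S * - S′) + β * (S * C′ + C * - S′) + γ)
        ≈⟨ +-congˡ (-‿cong (+-congʳ (+-cong
             (*-congˡ (trans (cos-+ θ (- φ))
               (+-cong (*-congˡ (cos-neg φ)) (-‿cong (*-congˡ (sin-neg φ))))))
             (*-congˡ (trans (sin-+ θ (- φ))
               (+-cong (*-congˡ (cos-neg φ)) (*-congˡ (sin-neg φ)))))))) ⟨
      (fromℕ 2 - fromℕ 2 * C′) * γ + fromℕ 2 * C′ * f θ - f (θ - φ)
        ∎
      where
      C = cos θ
      S = sin θ
      C′ = cos φ
      S′ = sin φ

-- The angle ω lies strictly between 0 and π.

module PrincipalArccos {c ℓ₁ ℓ₂ ℓ₃} (ℝ : RealNumbers c ℓ₁ ℓ₂ ℓ₃) where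
  open RealNumbers ℝ
  open Analysis ℝ
  open OrderedFieldProperties orderedField
  open IntegerRingSolver commutativeRing
  open Limits ℝ
  open Trigonometry ℝ
  open ≤-Reasoning

  module _ {π κ ω : Carrier} (isPi : IsPi π) (isArccos : IsArccos π κ ω)
           (-1<κ : - 1# < κ) (κ<1 : κ < 1#) where

    cos-arccos : cos ω ≈ κ
    cos-arccos = ⟶-unique (Cos-cos ω) (proj₂ (proj₂ isArccos))

    -- Within `δ` of `0#` cosine stays less than `1# - κ` away from `1#`, hence above `κ`, the value
    -- of `cos ω`. So `ω < δ` is impossible, and cotransitivity on `0# < δ` leaves `0# < ω`.
    0<arccos : 0# < ω
    0<arccos = [ (λ 0<ω → 0<ω) , (λ ω<δ → contradiction (impossible ω<δ) (<-irrefl refl)) ]′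
      (<-cotrans 0<δ ω)
      where
      near = cos-continuous 0# (1# - κ) (0<y-x κ<1)
      δ = proj₁ near
      0<δ = proj₁ (proj₂ near)
      impossible : ω < δ → κ < κ
      impossible ω<δ = begin-strict
        κ
          ≈⟨ solve 1 (λ κ → κ := (:- (con (+ 1) :- κ)) :+ con (+ 1)) refl κ ⟩
        - (1# - κ) + 1#
          <⟨ +-monoˡ-< 1# (proj₁ (proj₂ (proj₂ near) ω (∣∣<-resp
               (solve 1 (λ ω → ω := ω :- con (+ 0)) refl ω) refl (-δ<ω , ω<δ)))) ⟩
        cos ω - cos 0# + 1#
          ≈⟨ +-congʳ (+-cong cos-arccos (-‿cong cos-0)) ⟩
        κ - 1# + 1#
          ≈⟨ solve 1 (λ κ → κ :- con (+ 1) :+ con (+ 1) := κ) refl κ ⟩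
        κ
          ∎
        where
        -δ<ω : - δ < ω
        -δ<ω = begin-strict
          - δ   <⟨ neg-mono-< 0<δ ⟩
          - 0#  ≈⟨ solve 0 (:- con (+ 0) := con (+ 0)) refl ⟩
          0#    ≤⟨ proj₁ isArccos ⟩
          ω     ∎

    -- The mirror image at the other end: near `π` cosine stays below `κ`, with tolerance the gap
    -- between `κ` and `cos π`.
    arccos<π : ω < π
    arccos<π = [ (λ π-δ<ω → contradiction (impossible π-δ<ω) (<-irrefl refl)) , (λ ω<π → ω<π) ]′
      (<-cotrans π-δ<π ω)
      where
      near = cos-continuous π (κ - - 1#) (0<y-x -1<κ)
      δ = proj₁ near
      0<δ = proj₁ (proj₂ near)
      π-δ<π : π - δ < π
      π-δ<π = <-by 0<δ (solve 2 (λ π δ → π :- (π :- δ) := δ) refl π δ)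
      impossible : π - δ < ω → κ < κ
      impossible π-δ<ω = begin-strict
        κ
          ≈⟨ solve 1 (λ κ → κ := κ :- (:- con (+ 1)) :+ (:- con (+ 1))) refl κ ⟩
        κ - - 1# - 1#
          ≈⟨ +-congʳ (+-cong cos-arccos (-‿cong (cos-π isPi))) ⟨
        cos ω - cos π - 1#
          <⟨ +-monoˡ-< (- 1#) (proj₂ (proj₂ (proj₂ near) ω (-δ<ω-π , ω-π<δ))) ⟩
        κ - - 1# - 1#
          ≈⟨ solve 1 (λ κ → κ :- (:- con (+ 1)) :+ (:- con (+ 1)) := κ) refl κ ⟩
        κ
          ∎
        where
        -δ<ω-π : - δ < ω - π
        -δ<ω-π = <-by (0<y-x π-δ<ω)
          (solve 3 (λ π δ ω → ω :- π :- (:- δ) := ω :- (π :- δ)) refl π δ ω)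
        ω-π<δ : ω - π < δ
        ω-π<δ = ≤-<-trans
          (≤-by (0≤y-x (proj₁ (proj₂ isArccos)))
            (solve 2 (λ ω π → con (+ 0) :- (ω :- π) := π :- ω) refl ω π))
          0<δ

    -- A factor of a product apart from `0#` is itself apart from `0#`, so positivity of the square
    -- already makes `sin ω` a legitimate divisor for `β`.
    sin-arccos#0 : sin ω # 0#
    sin-arccos#0 = xy#0⇒x#0 (Equivalence.from #⇔<⊎> (inj₂
      (<-by (*-pos (0<y-x κ<1) (0<y-x -1<κ)) (begin-equality
        sin ω * sin ω - 0#
          ≈⟨ solve 2 (λ c s → s :* s :- con (+ 0) := c :* c :+ s :* s :- c :* c) refl (cos ω) (sin ω) ⟩
        cos ω * cos ω + sin ω * sin ω - cos ω * cos ω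
          ≈⟨ +-cong (cos²+sin²≈1 ω) (-‿cong (*-cong cos-arccos cos-arccos)) ⟩
        1# - κ * κ
          ≈⟨ solve 1 (λ κ → con (+ 1) :- κ :* κ := (con (+ 1) :- κ) :* (κ :- (:- con (+ 1)))) refl κ ⟩
        (1# - κ) * (κ - - 1#)
          ∎))))

-- Closed form of the recurrence and its period.

proposition3 : ∀ {c ℓ₁ ℓ₂ ℓ₃} (ℝ : RealNumbers c ℓ₁ ℓ₂ ℓ₃) →
  let open RealNumbers ℝ
      open Analysis ℝ
      2# = fromℕ 2
      2#0 = fromℕ#0 2
  in
  (A B C a b : Carrier) (F : ℕ → Carrier) →
  F 0 ≈ a →
  F 1 ≈ b →
  (∀ n → F (suc (suc n)) ≈ A + B * F (suc n) + C * F n) →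
  ∣ B ∣< 2# →
  C ≈ - 1# →
  (π ω : Carrier) →
  IsPi π →
  IsArccos π (B / 2# ⟨ 2#0 ⟩) ω →
  Σ[ ω#0 ∈ ω # 0# ]
    HasPeriod F ((2# * π) / ω ⟨ ω#0 ⟩) × 2# < (2# * π) / ω ⟨ ω#0 ⟩
proposition3 ℝ A B C a b F F0≈a F1≈b F-step (-2<B , B<2) C≈-1 π ω isPi isArccos =
  ω#0 , ((λ t → harmonic α β γ (ω * t)) ,
         continuous-scale harmonic-continuous harmonic-cong ω ,
         periodic ,
         λ n → sym (proj₁ (closed-form n))) ,
        2<T
  where
  open RealNumbers ℝ
  open OrderedFieldProperties orderedField
  open IntegerRingSolver commutativeRing
  open Trigonometry ℝ
  open PrincipalArccos ℝ
  open ≤-Reasoning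

  2# = fromℕ 2
  κ = B / 2# ⟨ fromℕ#0 2 ⟩

  2κ≈B : 2# * κ ≈ B
  2κ≈B = *-/-cancel (fromℕ#0 2)

  -1<κ : - 1# < κ
  -1<κ = *-cancelˡ-< (0<fromℕ-suc 1) (begin-strict
    2# * - 1#  ≈⟨ solve 1 (λ u → u :* (:- con (+ 1)) := :- u) refl 2# ⟩
    - 2#       <⟨ -2<B ⟩
    B          ≈⟨ 2κ≈B ⟨
    2# * κ     ∎)

  κ<1 : κ < 1#
  κ<1 = *-cancelˡ-< (0<fromℕ-suc 1) (begin-strict
    2# * κ     ≈⟨ 2κ≈B ⟩
    B          <⟨ B<2 ⟩
    2#         ≈⟨ *-identityʳ 2# ⟨
    2# * 1#    ∎)

  0<ω : 0# < ω
  0<ω = 0<arccos isPi isArccos -1<κ κ<1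

  ω#0 : ω # 0#
  ω#0 = Equivalence.from #⇔<⊎> (inj₂ 0<ω)

  2cosω≈B : 2# * cos ω ≈ B
  2cosω≈B = trans (*-congˡ (cos-arccos isPi isArccos -1<κ κ<1)) 2κ≈B

  sinω#0 : sin ω # 0#
  sinω#0 = sin-arccos#0 isPi isArccos -1<κ κ<1

  2-B#0 : 2# - B # 0#
  2-B#0 = Equivalence.from #⇔<⊎> (inj₂ (0<y-x B<2))

  -- γ is the constant solution of the recurrence; α and β fit a and b.
  γ = A / (2# - B) ⟨ 2-B#0 ⟩
  α = a - γ
  β = (b - γ - α * cos ω) / sin ω ⟨ sinω#0 ⟩

  open Harmonic α β γ

  T = (2# * π) / ω ⟨ ω#0 ⟩

  periodic : ∀ t → f (ω * (t + T)) ≈ f (ω * t)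
  periodic t = trans (harmonic-cong (begin-equality
    ω * (t + T)        ≈⟨ distribˡ ω t T ⟩
    ω * t + ω * T      ≈⟨ +-congˡ (*-/-cancel ω#0) ⟩
    ω * t + 2# * π
      ≈⟨ +-congˡ (solve 1 (λ π → (con (+ 1) :+ (con (+ 1) :+ con (+ 0))) :* π := π :+ π) refl π) ⟩
    ω * t + (π + π)    ∎))
    (harmonic-2π isPi (ω * t))

  -- The recurrence has order two, so the induction carries two consecutive values.
  closed-form : ∀ n → F n ≈ f (ω * fromℕ n) × F (suc n) ≈ f (ω * fromℕ (suc n))
  closed-form zero = F0 , F1
    where
    F0 : F 0 ≈ f (ω * 0#)
    F0 = begin-equality
      F 0                        ≈⟨ F0≈a ⟩
      a
        ≈⟨ solve 3 (λ a β γ → a := (a :- γ) :* con (+ 1) :+ β :* con (+ 0) :+ γ) refl a β γ ⟩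
      α * 1# + β * 0# + γ        ≈⟨ +-congʳ (+-cong (*-congˡ cos-0) (*-congˡ sin-0)) ⟨
      f 0#                       ≈⟨ harmonic-cong (zeroʳ ω) ⟨
      f (ω * 0#)                 ∎
    F1 : F 1 ≈ f (ω * fromℕ 1)
    F1 = begin-equality
      F 1                        ≈⟨ F1≈b ⟩
      b
        ≈⟨ solve 3 (λ b γ u → b := u :+ (b :- γ :- u) :+ γ) refl b γ (α * cos ω) ⟩
      α * cos ω + (b - γ - α * cos ω) + γ
        ≈⟨ +-congʳ (+-congˡ (*-/-cancel sinω#0)) ⟨
      α * cos ω + sin ω * β + γ  ≈⟨ +-congʳ (+-congˡ (*-comm (sin ω) β)) ⟩
      f ω                        ≈⟨ harmonic-cong (trans (*-congˡ (+-identityʳ 1#)) (*-identityʳ ω)) ⟨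
      f (ω * fromℕ 1)            ∎
  closed-form (suc n) = proj₂ (closed-form n) , (begin-equality
    F (suc (suc n))
      ≈⟨ F-step n ⟩
    A + B * F (suc n) + C * F n
      ≈⟨ +-cong (+-congˡ (*-congˡ (proj₂ (closed-form n)))) (*-cong C≈-1 (proj₁ (closed-form n))) ⟩
    A + B * f θ + - 1# * f (ω * fromℕ n)
      -- Centred at the angle `θ` of index `suc n`, index `n` sits at `θ - ω` and the next one at
      -- `θ + ω`, as `harmonic-recurrence` requires.
      ≈⟨ +-congˡ (*-congˡ (harmonic-cong
           (solve 2 (λ ω m → ω :* m := ω :* (con (+ 1) :+ m) :- ω) refl ω (fromℕ n)))) ⟩
    A + B * f θ + - 1# * f (θ - ω)
      ≈⟨ solve 2 (λ u v → u :+ (:- con (+ 1)) :* v := u :- v) refl (A + B * f θ) (f (θ - ω)) ⟩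
    A + B * f θ - f (θ - ω)
      ≈⟨ +-congʳ (+-congʳ (*-/-cancel 2-B#0)) ⟨
    (2# - B) * γ + B * f θ - f (θ - ω)
      ≈⟨ +-congʳ (+-cong (*-congʳ (+-congˡ (-‿cong 2cosω≈B))) (*-congʳ 2cosω≈B)) ⟨
    (2# - 2# * cos ω) * γ + 2# * cos ω * f θ - f (θ - ω)
      ≈⟨ harmonic-recurrence θ ω ⟨
    f (θ + ω)
      ≈⟨ harmonic-cong (solve 2 (λ ω m → ω :* m :+ ω := ω :* (con (+ 1) :+ m)) refl ω (fromℕ (suc n))) ⟩
    f (ω * fromℕ (suc (suc n)))
      ∎)
    where θ = ω * fromℕ (suc n)

  2<T : 2# < T
  2<T = *-cancelˡ-< 0<ω (begin-strict
    ω * 2#     ≈⟨ *-comm ω 2# ⟩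
    2# * ω     <⟨ *-monoʳ-< (0<fromℕ-suc 1) (arccos<π isPi isArccos -1<κ κ<1) ⟩
    2# * π     ≈⟨ *-/-cancel ω#0 ⟨
    ω * T      ∎)
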